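{- Let $n\ge3$. The Kostka-Foulkes polynomials $K^{C_n}_{\lambda,\mu}(q)$ for partitions $\lambda$ with $2\le|\lambda|\le3$ and $\mu$ with $|\mu|\le2$ are as follows (partitions are completed by zeros to length $n$; $\emptyset$ denotes the zero weight). $\lambda=(3)$: $K_{(3),(2)}=K_{(3),(1,1)}=K_{(3),\emptyset}=0$; $K_{(3),(1)}=q\,\frac{q^{2n}-1}{q^2-1}$. $\lambda=(2,1)$: $K_{(2,1),(2)}=K_{(2,1),(1,1)}=K_{(2,1),\emptyset}=0$; $K_{(2,1),(1)}=q\,\frac{q^{2n-2}-1}{q-1}$. $\lambda=(1,1,1)$: $K_{(1,1,1),(2)}=K_{(1,1,1),(1,1)}=K_{(1,1,1),\emptyset}=0$; $K_{(1,1,1),(1)}=q^2\,\frac{q^{2n-4}-1}{q^2-1}$. $\lambda=(2)$: $K_{(2),(2)}=1$; $K_{(2),(1,1)}=q$; $K_{(2),(1)}=0$; $K_{(2),\emptyset}=q\,\frac{q^{2n}-1}{q^2-1}$. $\lambda=(1,1)$: $K_{(1,1),(2)}=0$; $K_{(1,1),(1,1)}=1$; $K_{(1,1),(1)}=0$; $K_{(1,1),\emptyset}=q^2\,\frac{q^{2n-2}-1}{q^2-1}$.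
   Context: Write $\beta=(\beta_{\overline n},\dots,\beta_{\overline 1})$ for $\sum_i\beta_{\overline i}\varepsilon_{\overline i}$, $(\varepsilon_{\overline i})$ an orthonormal basis of $\mathbb R^n$; a partition $(\lambda_1\ge\lambda_2\ge\cdots)$ with at most $n$ parts is the dominant weight with $\lambda_{\overline n}=\lambda_1,\lambda_{\overline{n-1}}=\lambda_2,\dots$. For type $C_n$ ($sp_{2n}$) the positive roots are $\varepsilon_{\overline i}\pm\varepsilon_{\overline j}$ ($1\le j<i\le n$) and $2\varepsilon_{\overline i}$ ($1\le i\le n$), $\rho=(n,n-1,\dots,1)$, and $W$ is the group of signed permutations of the coordinates, with length $l$. The $q$-partition function is defined by $\prod_{\alpha\in R^+}\frac1{1-qx^\alpha}=\sum_\beta\mathcal P_q(\beta)x^\beta$ ($\mathcal P_q(\beta)=0$ if $\beta$ is not a nonnegative integral combination of positive roots), and $K_{\lambda,\mu}(q)=\sum_{\sigma\in W}(-1)^{l(\sigma)}\mathcal P_q(\sigma(\lambda+\rho)-(\mu+\rho))$. -}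

module Defs where

open import Data.Bool.Base using (if_then_else_; _∧_)
open import Data.Fin.Base as Fin using (Fin)
open import Data.Fin.Permutation using (Permutation′; _⟨$⟩ʳ_; insert)
  renaming (id to idₚ)
open import Data.Fin.Properties using () renaming (_<?_ to _<ᶠ?_)
open import Data.Integer.Base using (ℤ; +_; 0ℤ; 1ℤ; -1ℤ; -_; _+_; _-_; _*_; _^_)
open import Data.Integer.Properties using () renaming (_≟_ to _≟ᶻ_)
open import Data.List.Base as List
  using (List; []; _∷_; _++_; concatMap; cartesianProduct; cartesianProductWith; allFin; filter; foldr; length; upTo)
import Data.List.Membership.DecPropositional as DecMembership
open import Data.Nat.Base using (ℕ; zero; suc; _∸_)
open import Data.Nat.Properties using (_≟_)
open import Data.Product.Base using (_×_; _,_)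
open import Data.Sign.Base using (Sign)
open import Data.Vec.Base as Vec using (Vec; []; _∷_; lookup; tabulate; zipWith; replicate; _[_]≔_)
open import Data.Vec.Properties using (≡-dec)
open import Relation.Binary.Definitions using (DecidableEquality)
open import Relation.Binary.PropositionalEquality using (_≡_)
open import Relation.Nullary.Decidable using (does; ¬?)

sumℤ : List ℤ → ℤ
sumℤ = foldr _+_ 0ℤ

-- Polynomials (more generally formal power series) in q over ℤ: f k is the
-- coefficient of q^k.  Two of them are equal when all coefficients agree.

Series : Set
Series = ℕ → ℤ

infix  4 _≈_ _≈_÷_
infixl 6 _⊖_
infixl 7 _⊛_

_≈_ : Series → Series → Set
f ≈ g = ∀ k → f k ≡ g k

q^ : ℕ → Series
q^ m k = if does (m ≟ k) then 1ℤ else 0ℤ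

𝟘 𝟙 : Series
𝟘 k = 0ℤ
𝟙 = q^ 0

_⊖_ : Series → Series → Series
(f ⊖ g) k = f k - g k

_⊛_ : Series → Series → Series
(f ⊛ g) k = sumℤ (List.map (λ i → f i * g (k ∸ i)) (upTo (suc k)))

-- f is the fraction g / h.  As ℤ[[q]] is an integral domain, this determines
-- f as soon as h is nonzero; it is only used with h = q^m − 1, m > 0.
_≈_÷_ : Series → Series → Series → Set
f ≈ g ÷ h = f ⊛ h ≈ g

-- A weight β is written (β_n̄ , … , β_1̄): the entry at position a (counted
-- from 0) is the coordinate of index n − a, so a larger index i is a smaller
-- position.

Weight : ℕ → Set
Weight n = Vec ℤ n

_≟ʷ_ : ∀ {n} → DecidableEquality (Weight n)
_≟ʷ_ = ≡-dec _≟ᶻ_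

module _ {n : ℕ} where
  open DecMembership (_≟ʷ_ {n}) public using (_∈?_)

infixl 6 _+ʷ_ _-ʷ_

_+ʷ_ _-ʷ_ : ∀ {n} → Weight n → Weight n → Weight n
_+ʷ_ = zipWith _+_
_-ʷ_ = zipWith _-_

0ʷ : ∀ {n} → Weight n
0ʷ = replicate _ 0ℤ

ε : ∀ {n} → Fin n → Weight n
ε a = 0ʷ [ a ]≔ 1ℤ

ρ : ∀ n → Weight n
ρ zero    = []
ρ (suc n) = + suc n ∷ ρ n

-- Completion by zeros; a list with more than n parts would be truncated.
complete : ∀ n → List ℕ → Weight n
complete zero    _        = []
complete (suc n) []       = 0ℤ ∷ complete n []
complete (suc n) (x ∷ xs) = + x ∷ complete n xs

-- R⁺ in type C_n; each positive root occurs exactly once.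
positiveRoots : ∀ n → List (Weight n)
positiveRoots n = concatMap (λ (a , b) → ε a +ʷ ε b ∷ ε a -ʷ ε b ∷ []) pairs
               ++ List.map (λ a → ε a +ʷ ε a) (allFin n)
  where
  pairs : List (Fin n × Fin n)
  pairs = filter (λ (a , b) → a <ᶠ? b) (cartesianProduct (allFin n) (allFin n))

-- Formal series in q and the x^β: F k β is the coefficient of q^k x^β.
WeightSeries : ℕ → Set
WeightSeries n = ℕ → Weight n → ℤ

one : ∀ {n} → WeightSeries n
one k β = if does (k ≟ 0) ∧ does (β ≟ʷ 0ʷ) then 1ℤ else 0ℤ

-- The quotient F of G by 1 − q x^α, i.e. the unique solution of
-- F = G + q x^α F.
divide : ∀ {n} → Weight n → WeightSeries n → WeightSeries n
divide α G zero    β = G zero β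
divide α G (suc k) β = G (suc k) β + divide α G k (β -ʷ α)

-- 𝒫 β is the coefficient of x^β in ∏_{α ∈ R⁺} 1 / (1 − q x^α).
𝒫 : ∀ {n} → Weight n → Series
𝒫 {n} β k = foldr divide one (positiveRoots n) k β

-- The signed permutation (π , s) acts by β ↦ (s_a β_{π a})_a.
SignedPermutation : ℕ → Set
SignedPermutation n = Permutation′ n × Vec Sign n

signed : Sign → ℤ → ℤ
signed Sign.+ z = z
signed Sign.- z = - z

infixr 8 _·_

_·_ : ∀ {n} → SignedPermutation n → Weight n → Weight n
(π , s) · β = tabulate (λ a → signed (lookup s a) (lookup β (π ⟨$⟩ʳ a)))

-- Every permutation of Fin (suc n) arises exactly once, from the image j of 0
-- and a permutation of the remaining n positions.
allPermutations : ∀ n → List (Permutation′ n)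
allPermutations zero    = idₚ ∷ []
allPermutations (suc n) =
  cartesianProductWith (insert Fin.zero) (allFin (suc n)) (allPermutations n)

allSigns : ∀ n → List (Vec Sign n)
allSigns zero    = [] ∷ []
allSigns (suc n) = cartesianProductWith _∷_ (Sign.+ ∷ Sign.- ∷ []) (allSigns n)

W : ∀ n → List (SignedPermutation n)
W n = cartesianProduct (allPermutations n) (allSigns n)

-- Length: the number of positive roots made negative.  As σ permutes the roots, so a root
-- σ · α that is not positive is negative.
ℓ : ∀ {n} → SignedPermutation n → ℕ
ℓ {n} σ = length (filter (λ α → ¬? (σ · α ∈? positiveRoots n)) (positiveRoots n))

kostkaFoulkes : ∀ {n} → Weight n → Weight n → Series
kostkaFoulkes {n} lam μ k =
  sumℤ (List.map (λ σ → -1ℤ ^ ℓ σ * 𝒫 (σ · (lam +ʷ ρ n) -ʷ (μ +ʷ ρ n)) k) (W n))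

K : ∀ n → List ℕ → List ℕ → Series
K n lam μ = kostkaFoulkes (complete n lam) (complete n μ)

{-# OPTIONS --safe #-}

-- Expanding the alternating sum over W along the first coordinate (the image
-- of the leading entry) and 𝒫 along the roots involving the first coordinate
-- gives a recursion on the rank (a Morris-type recurrence).  It involves
-- K_{λ,μ} with μ not dominant, but the sums
--   ∑_v K_{(1),v},  ∑_{v,w} K_{∅,v+w},  ∑_{v≤w} K_{∅,v+w}
-- over the weights v, w = ±ε_i of the vector representation, together with
-- K_{(2),∅}, satisfy a closed system of recurrences in the rank.  Its solution is
-- 1 + q + ⋯ + q^(2m−1) for the first two and q + q³ + ⋯ + q^(2m−1) for the
-- other two, and all entries with |λ| − |μ| even are read off from these.
-- If |λ| − |μ| is odd, no argument of 𝒫 lies in the root lattice.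

module Submission where

open import Defs
open import Data.Bool.Base using (true; false; not; if_then_else_)
open import Data.Bool.Properties using (∧-zeroʳ)
open import Data.Fin.Base as Fin using (Fin; toℕ; punchIn)
open import Data.Fin.Permutation using (Permutation′; _⟨$⟩ʳ_; _⟨$⟩ˡ_; insert; inverseˡ; inverseʳ)
open import Data.Fin.Properties using () renaming (_<?_ to _<ᶠ?_)
open import Data.Integer.Base using (ℤ; +_; -[1+_]; +<+; -<+; 0ℤ; 1ℤ; -1ℤ; -_; _+_; _-_; _*_; _^_; _<_)
open import Data.Integer.Properties
open import Data.Integer.Tactic.RingSolver using (solve-∀)
open import Data.List.Base as List
  using (List; []; _∷_; _++_; concatMap; cartesianProduct; cartesianProductWith; allFin; filter; foldr; length; upTo; map)
open import Data.List.Properties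
  using (map-++; map-∘; map-cong; map-tabulate; map-applyUpTo; filter-++; concatMap-++; concatMap-map; map-concatMap; ++-assoc; foldr-++)
open import Data.List.Membership.Propositional using (_∈_)
open import Data.List.Membership.Propositional.Properties using (∈-map⁺; ∈-map⁻; ∈-++⁺ˡ; ∈-++⁺ʳ; ∈-++⁻)
open import Data.List.Relation.Unary.Any using (here; there)
open import Data.Nat.Base as ℕ using (ℕ; zero; suc; z≤n; s≤s)
open import Data.Nat.ListAction using (sum)
import Data.Nat.Properties as ℕₚ
open import Data.Product.Base using (_×_; _,_; proj₁; proj₂; ∃)
open import Data.Sign.Base using (Sign)
open import Data.Sum.Base using (_⊎_; inj₁; inj₂)
open import Data.Vec.Base using ([]; _∷_; lookup; removeAt; tabulate; _[_]≔_)
import Data.Vec.Properties as Vecₚ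
open import Data.Vec.Relation.Unary.All as All using (All; []; _∷_)
open import Function.Base using (_∘_; id)
open import Relation.Binary.PropositionalEquality
  using (_≡_; _≢_; refl; sym; trans; cong; cong₂; subst; module ≡-Reasoning)
open import Relation.Nullary.Decidable using (Dec; yes; no; does; ¬?; dec-true; dec-false)
open import Relation.Nullary.Negation using (¬_)

-- Everything is stated for a = λ + ρ instead of λ: deleting an entry of a leaves a vector λ′ + ρ of
-- the next lower rank, so the expansion stays within one family. If b is the first coordinate of μ
-- + ρ, choosing the entry y with a sign leaves ±y - b as first coordinate in the argument of 𝒫. No
-- positive root has a negative first coordinate, so for b ≥ 0 only +y with y ≥ b survives. Here y -
-- b never exceeds 2, and this is why 𝒫 is expanded for first coordinates 0, 1 and 2 only. First
-- coordinate 1 uses up one root ε₀ + v; first coordinate 2 uses up 2ε₀ or two roots ε₀ + v, ε₀ + w.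
-- Subtracting v from the argument of 𝒫 amounts to adding v to μ. Hence μ leaves the dominant
-- chamber, and sums over v or over pairs appear instead of single values. A first coordinate -1 or
-- -2 of μ lowers b and lets two or three entries survive. The additional terms have λ = (1), (2) or
-- (1,1), and the last of these is expressed by the first two, which closes the system.

+ʷ-identityˡ : ∀ {n} (v : Weight n) → 0ʷ +ʷ v ≡ v
+ʷ-identityˡ []      = refl
+ʷ-identityˡ (x ∷ v) = cong₂ _∷_ (+-identityˡ x) (+ʷ-identityˡ v)

+ʷ-identityʳ : ∀ {n} (v : Weight n) → v +ʷ 0ʷ ≡ v
+ʷ-identityʳ []      = refl
+ʷ-identityʳ (x ∷ v) = cong₂ _∷_ (+-identityʳ x) (+ʷ-identityʳ v)

-ʷ-identityʳ : ∀ {n} (v : Weight n) → v -ʷ 0ʷ ≡ v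
-ʷ-identityʳ []      = refl
-ʷ-identityʳ (x ∷ v) = cong₂ _∷_ (+-identityʳ x) (-ʷ-identityʳ v)

+ʷ-comm : ∀ {n} (u v : Weight n) → u +ʷ v ≡ v +ʷ u
+ʷ-comm []      []      = refl
+ʷ-comm (x ∷ u) (y ∷ v) = cong₂ _∷_ (+-comm x y) (+ʷ-comm u v)

+ʷ-assoc : ∀ {n} (u v w : Weight n) → (u +ʷ v) +ʷ w ≡ u +ʷ (v +ʷ w)
+ʷ-assoc []      []      []      = refl
+ʷ-assoc (x ∷ u) (y ∷ v) (z ∷ w) = cong₂ _∷_ (+-assoc x y z) (+ʷ-assoc u v w)

-ʷ-+ʷ : ∀ {n} (u v w : Weight n) → (u -ʷ v) -ʷ w ≡ u -ʷ (v +ʷ w)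
-ʷ-+ʷ []      []      []      = refl
-ʷ-+ʷ (x ∷ u) (y ∷ v) (z ∷ w) = cong₂ _∷_ (lemma x y z) (-ʷ-+ʷ u v w)
  where
  lemma : ∀ x y z → (x - y) - z ≡ x - (y + z)
  lemma = solve-∀

-- Positive roots of rank n + 1 in terms of rank n

shortRoots : ∀ n → List (Weight n)
shortRoots n = concatMap (λ (a , b) → ε a +ʷ ε b ∷ ε a -ʷ ε b ∷ [])
  (filter (λ (a , b) → a <ᶠ? b) (cartesianProduct (allFin n) (allFin n)))

longRoots : ∀ n → List (Weight n)
longRoots n = map (λ a → ε a +ʷ ε a) (allFin n)

-- The weights ±ε_i of the vector representation.
V : ∀ n → List (Weight n)
V zero    = []
V (suc n) = (1ℤ ∷ 0ʷ) ∷ (-1ℤ ∷ 0ʷ) ∷ map (0ℤ ∷_) (V n)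

module _ where
  private
    both : ∀ {m n} → Fin m × Fin n → Fin (suc m) × Fin (suc n)
    both (a , b) = Fin.suc a , Fin.suc b

    allFin-suc : ∀ n → allFin (suc n) ≡ Fin.zero ∷ map Fin.suc (allFin n)
    allFin-suc n = cong (Fin.zero ∷_) (sym (map-tabulate id Fin.suc))

    lt? : ∀ {m n} (p : Fin m × Fin n) → Dec (toℕ (proj₁ p) ℕ.< toℕ (proj₂ p))
    lt? (a , b) = toℕ a ℕₚ.<? toℕ b

    filter-zero : ∀ {m n} (ys : List (Fin n)) →
      filter lt? (map (Fin.zero {m} ,_) (map Fin.suc ys)) ≡ map (λ b → Fin.zero , Fin.suc b) ys
    filter-zero []       = refl
    filter-zero (y ∷ ys) = cong (_ ∷_) (filter-zero ys)

    filter-row : ∀ {m n} (x : Fin m) (ys : List (Fin n)) →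
      filter lt? (map (Fin.suc x ,_) (map Fin.suc ys)) ≡ map both (filter lt? (map (x ,_) ys))
    filter-row x []       = refl
    filter-row x (y ∷ ys) with toℕ x ℕ.<ᵇ toℕ y
    ... | true  = cong (_ ∷_) (filter-row x ys)
    ... | false = filter-row x ys

    filter-suc : ∀ {m n} (xs : List (Fin m)) (ys : List (Fin n)) →
      filter lt? (cartesianProduct (map Fin.suc xs) (Fin.zero ∷ map Fin.suc ys)) ≡
      map both (filter lt? (cartesianProduct xs ys))
    filter-suc []       ys = refl
    filter-suc (x ∷ xs) ys = begin
      filter lt? (map (Fin.suc x ,_) (map Fin.suc ys) ++ rest)
        ≡⟨ filter-++ lt? (map (Fin.suc x ,_) (map Fin.suc ys)) rest ⟩
      filter lt? (map (Fin.suc x ,_) (map Fin.suc ys)) ++ filter lt? rest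
        ≡⟨ cong₂ _++_ (filter-row x ys) (filter-suc xs ys) ⟩
      map both (filter lt? (map (x ,_) ys)) ++ map both (filter lt? (cartesianProduct xs ys))
        ≡⟨ map-++ both (filter lt? (map (x ,_) ys)) _ ⟨
      map both (filter lt? (map (x ,_) ys) ++ filter lt? (cartesianProduct xs ys))
        ≡⟨ cong (map both) (filter-++ lt? (map (x ,_) ys) (cartesianProduct xs ys)) ⟨
      map both (filter lt? (cartesianProduct (x ∷ xs) ys)) ∎
      where
      open ≡-Reasoning
      rest = cartesianProduct (map Fin.suc xs) (Fin.zero ∷ map Fin.suc ys)

    pairs-suc : ∀ n → filter lt? (cartesianProduct (allFin (suc n)) (allFin (suc n))) ≡
      map (λ b → Fin.zero , Fin.suc b) (allFin n) ++
      map both (filter lt? (cartesianProduct (allFin n) (allFin n)))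
    pairs-suc n = begin
      filter lt? (cartesianProduct (allFin (suc n)) (allFin (suc n)))
        ≡⟨ cong (λ xs → filter lt? (cartesianProduct xs xs)) (allFin-suc n) ⟩
      filter lt? (map (Fin.zero ,_) (map Fin.suc (allFin n)) ++ rest)
        ≡⟨ filter-++ lt? (map (Fin.zero ,_) (map Fin.suc (allFin n))) rest ⟩
      filter lt? (map (Fin.zero ,_) (map Fin.suc (allFin n))) ++ filter lt? rest
        ≡⟨ cong₂ _++_ (filter-zero (allFin n)) (filter-suc (allFin n) (allFin n)) ⟩
      _ ∎
      where
      open ≡-Reasoning
      rest = cartesianProduct (map Fin.suc (allFin n)) (Fin.zero ∷ map Fin.suc (allFin n))

    ±ε : ∀ {n} → Fin n → List (Weight n)
    ±ε a = ε a ∷ (0ʷ -ʷ ε a) ∷ []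

  -- `V` lists -ε_i right after ε_i, in the order in which `shortRoots` produces ε_a + ε_b and ε_a -
  -- ε_b; hence an equality of lists, not merely one up to permutation.
  V-± : ∀ n → V n ≡ concatMap ±ε (allFin n)
  V-± zero    = refl
  V-± (suc n) = cong₂ _∷_ refl (cong₂ _∷_ (cong (-1ℤ ∷_) (sym (-ʷ-identityʳ 0ʷ))) (begin
    map (0ℤ ∷_) (V n)
      ≡⟨ cong (map (0ℤ ∷_)) (V-± n) ⟩
    map (0ℤ ∷_) (concatMap ±ε (allFin n))
      ≡⟨ map-concatMap (0ℤ ∷_) ±ε (allFin n) ⟩
    concatMap (±ε ∘ Fin.suc) (allFin n)
      ≡⟨ concatMap-map ±ε Fin.suc (allFin n) ⟨
    concatMap ±ε (map Fin.suc (allFin n))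
      ≡⟨ cong (concatMap ±ε) (map-tabulate id Fin.suc) ⟩
    _ ∎))
    where open ≡-Reasoning

  -- The pairs (0 , b) give ε₀ ± ε_b, that is, 1 followed by a weight of `V n`; the other pairs are
  -- those of rank n moved by one position.
  shortRoots-suc : ∀ n → shortRoots (suc n) ≡ map (1ℤ ∷_) (V n) ++ map (0ℤ ∷_) (shortRoots n)
  shortRoots-suc n = begin
    concatMap f (filter lt? (cartesianProduct (allFin (suc n)) (allFin (suc n))))
      ≡⟨ cong (concatMap f) (pairs-suc n) ⟩
    concatMap f (map (λ b → Fin.zero , Fin.suc b) (allFin n) ++ map both ps)
      ≡⟨ concatMap-++ f (map (λ b → Fin.zero , Fin.suc b) (allFin n)) _ ⟩
    concatMap f (map (λ b → Fin.zero , Fin.suc b) (allFin n)) ++ concatMap f (map both ps)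
      ≡⟨ cong₂ _++_ first second ⟩
    map (1ℤ ∷_) (V n) ++ map (0ℤ ∷_) (shortRoots n) ∎
    where
    open ≡-Reasoning
    f : ∀ {n} → Fin n × Fin n → List (Weight n)
    f (a , b) = ε a +ʷ ε b ∷ ε a -ʷ ε b ∷ []

    ps = filter lt? (cartesianProduct (allFin n) (allFin n))

    first : concatMap f (map (λ b → Fin.zero , Fin.suc b) (allFin n)) ≡ map (1ℤ ∷_) (V n)
    first = begin
      concatMap f (map (λ b → Fin.zero , Fin.suc b) (allFin n))
        ≡⟨ concatMap-map f _ (allFin n) ⟩
      concatMap (λ b → f (Fin.zero , Fin.suc b)) (allFin n)
        ≡⟨ cong List.concat (map-cong (λ b → cong (λ w → (1ℤ ∷ w) ∷ (1ℤ ∷ (0ʷ -ʷ ε b)) ∷ []) (+ʷ-identityˡ (ε b))) (allFin n)) ⟩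
      concatMap (map (1ℤ ∷_) ∘ ±ε) (allFin n)
        ≡⟨ map-concatMap (1ℤ ∷_) ±ε (allFin n) ⟨
      map (1ℤ ∷_) (concatMap ±ε (allFin n))
        ≡⟨ cong (map (1ℤ ∷_)) (V-± n) ⟨
      map (1ℤ ∷_) (V n) ∎

    second : concatMap f (map both ps) ≡ map (0ℤ ∷_) (shortRoots n)
    second = trans (concatMap-map f both ps) (sym (map-concatMap (0ℤ ∷_) f ps))

  longRoots-suc : ∀ n → longRoots (suc n) ≡ (+ 2 ∷ 0ʷ) ∷ map (0ℤ ∷_) (longRoots n)
  longRoots-suc n = cong₂ _∷_ (cong (+ 2 ∷_) (+ʷ-identityˡ 0ʷ)) (begin
    map g (List.tabulate Fin.suc)          ≡⟨ cong (map g) (map-tabulate id Fin.suc) ⟨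
    map g (map Fin.suc (allFin n))         ≡⟨ map-∘ (allFin n) ⟨
    map (λ a → 0ℤ ∷ g a) (allFin n)        ≡⟨ map-∘ (allFin n) ⟩
    map (0ℤ ∷_) (longRoots n)              ∎)
    where
    open ≡-Reasoning
    g : ∀ {n} → Fin n → Weight n
    g a = ε a +ʷ ε a

positiveRoots-suc : ∀ n → positiveRoots (suc n) ≡
  map (1ℤ ∷_) (V n) ++ map (0ℤ ∷_) (shortRoots n) ++ (+ 2 ∷ 0ʷ) ∷ map (0ℤ ∷_) (longRoots n)
positiveRoots-suc n = trans (cong₂ _++_ (shortRoots-suc n) (longRoots-suc n))
  (++-assoc (map (1ℤ ∷_) (V n)) _ _)

-- Finite sums and products

∑ ∏ : ∀ {A : Set} → List A → (A → ℤ) → ℤ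
∑ xs f = sumℤ (map f xs)
∏ xs f = foldr (λ x → f x *_) 1ℤ xs

module _ {A : Set} where

  ∑-cong : ∀ xs {f g : A → ℤ} → (∀ x → f x ≡ g x) → ∑ xs f ≡ ∑ xs g
  ∑-cong xs f≗g = cong sumℤ (map-cong f≗g xs)

  ∑-++ : ∀ xs ys (f : A → ℤ) → ∑ (xs ++ ys) f ≡ ∑ xs f + ∑ ys f
  ∑-++ []       ys f = sym (+-identityˡ _)
  ∑-++ (x ∷ xs) ys f = trans (cong (_+_ (f x)) (∑-++ xs ys f)) (sym (+-assoc (f x) _ _))

  ∑-zero : ∀ xs {f : A → ℤ} → (∀ x → f x ≡ 0ℤ) → ∑ xs f ≡ 0ℤ
  ∑-zero []       f≡0 = refl
  ∑-zero (x ∷ xs) f≡0 = cong₂ _+_ (f≡0 x) (∑-zero xs f≡0)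

  ∑-+ : ∀ xs (f g : A → ℤ) → ∑ xs (λ x → f x + g x) ≡ ∑ xs f + ∑ xs g
  ∑-+ []       f g = refl
  ∑-+ (x ∷ xs) f g = trans (cong (_+_ (f x + g x)) (∑-+ xs f g)) (lemma (f x) (g x) _ _)
    where
    lemma : ∀ a b c d → a + b + (c + d) ≡ a + c + (b + d)
    lemma = solve-∀

  ∑-* : ∀ xs c (f : A → ℤ) → ∑ xs (λ x → c * f x) ≡ c * ∑ xs f
  ∑-* []       c f = sym (*-zeroʳ c)
  ∑-* (x ∷ xs) c f = trans (cong (_+_ (c * f x)) (∑-* xs c f)) (sym (*-distribˡ-+ c _ _))

  ∑-map : ∀ {B : Set} xs (h : B → A) (f : A → ℤ) → ∑ (map h xs) f ≡ ∑ xs (f ∘ h)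
  ∑-map xs h f = cong sumℤ (sym (map-∘ xs))

  ∏-cong : ∀ xs {f g : A → ℤ} → (∀ x → f x ≡ g x) → ∏ xs f ≡ ∏ xs g
  ∏-cong []       f≗g = refl
  ∏-cong (x ∷ xs) f≗g = cong₂ _*_ (f≗g x) (∏-cong xs f≗g)

  ∏-++ : ∀ xs ys (f : A → ℤ) → ∏ (xs ++ ys) f ≡ ∏ xs f * ∏ ys f
  ∏-++ []       ys f = sym (*-identityˡ _)
  ∏-++ (x ∷ xs) ys f = trans (cong (f x *_) (∏-++ xs ys f)) (sym (*-assoc (f x) (∏ xs f) (∏ ys f)))

  ∏-map : ∀ {B : Set} xs (h : B → A) (f : A → ℤ) → ∏ (map h xs) f ≡ ∏ xs (f ∘ h)
  ∏-map []       h f = refl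
  ∏-map (x ∷ xs) h f = cong (f (h x) *_) (∏-map xs h f)

∑-product : ∀ {A B C : Set} (h : A → B → C) xs ys (f : C → ℤ) →
  ∑ (cartesianProductWith h xs ys) f ≡ ∑ xs (λ x → ∑ ys (λ y → f (h x y)))
∑-product h []       ys f = refl
∑-product h (x ∷ xs) ys f = trans (∑-++ (map (h x) ys) _ f)
  (cong₂ _+_ (∑-map ys (h x) f) (∑-product h xs ys f))

-- In the list, 2ε₀ separates the short from the long roots with first coordinate zero;
-- commutativity joins the two into the roots of rank n.
∏-positiveRoots-suc : ∀ n (F : Weight (suc n) → ℤ) → ∏ (positiveRoots (suc n)) F ≡
  ∏ (V n) (F ∘ (1ℤ ∷_)) * (∏ (positiveRoots n) (F ∘ (0ℤ ∷_)) * F (+ 2 ∷ 0ʷ))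
∏-positiveRoots-suc n F = begin
  ∏ (positiveRoots (suc n)) F
    ≡⟨ cong (λ xs → ∏ xs F) (positiveRoots-suc n) ⟩
  ∏ (map (1ℤ ∷_) (V n) ++ map (0ℤ ∷_) (shortRoots n) ++ (+ 2 ∷ 0ʷ) ∷ map (0ℤ ∷_) (longRoots n)) F
    ≡⟨ ∏-++ (map (1ℤ ∷_) (V n)) _ F ⟩
  ∏ (map (1ℤ ∷_) (V n)) F * ∏ (map (0ℤ ∷_) (shortRoots n) ++ (+ 2 ∷ 0ʷ) ∷ map (0ℤ ∷_) (longRoots n)) F
    ≡⟨ cong₂ _*_ (∏-map (V n) _ F) (∏-++ (map (0ℤ ∷_) (shortRoots n)) _ F) ⟩
  ∏ (V n) (F ∘ (1ℤ ∷_)) * (∏ (map (0ℤ ∷_) (shortRoots n)) F * (F (+ 2 ∷ 0ʷ) * ∏ (map (0ℤ ∷_) (longRoots n)) F))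
    ≡⟨ cong (λ x → ∏ (V n) (F ∘ (1ℤ ∷_)) * x)
         (cong₂ (λ x y → x * (F (+ 2 ∷ 0ʷ) * y)) (∏-map (shortRoots n) _ F) (∏-map (longRoots n) _ F)) ⟩
  ∏ (V n) (F ∘ (1ℤ ∷_)) * (s * (F (+ 2 ∷ 0ʷ) * l))
    ≡⟨ cong (∏ (V n) (F ∘ (1ℤ ∷_)) *_) (lemma s (F (+ 2 ∷ 0ʷ)) l) ⟩
  ∏ (V n) (F ∘ (1ℤ ∷_)) * (s * l * F (+ 2 ∷ 0ʷ))
    ≡⟨ cong (λ x → ∏ (V n) (F ∘ (1ℤ ∷_)) * (x * F (+ 2 ∷ 0ʷ))) (∏-++ (shortRoots n) (longRoots n) (F ∘ (0ℤ ∷_))) ⟨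
  _ ∎
  where
  open ≡-Reasoning
  s = ∏ (shortRoots n) (F ∘ (0ℤ ∷_))
  l = ∏ (longRoots n) (F ∘ (0ℤ ∷_))
  lemma : ∀ a b c → a * (b * c) ≡ a * c * b
  lemma = solve-∀

-- The signature

module _ {n : ℕ} where

  private
    R′ = map (0ℤ ∷_) (shortRoots n) ++ (+ 2 ∷ 0ʷ) ∷ map (0ℤ ∷_) (longRoots n)

  positiveRoots-suc⁻ : ∀ {x} {β : Weight n} → x ∷ β ∈ positiveRoots (suc n) →
    (x ≡ 1ℤ × β ∈ V n) ⊎ (x ≡ 0ℤ × β ∈ positiveRoots n) ⊎ (x ≡ + 2 × β ≡ 0ʷ)
  positiveRoots-suc⁻ {x} {β} p
    with ∈-++⁻ (map (1ℤ ∷_) (V n)) (subst (λ R → x ∷ β ∈ R) (positiveRoots-suc n) p)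
  ... | inj₁ q with β , β∈ , refl ← ∈-map⁻ (1ℤ ∷_) q = inj₁ (refl , β∈)
  ... | inj₂ q with ∈-++⁻ (map (0ℤ ∷_) (shortRoots n)) q
  ...   | inj₁ r with β , β∈ , refl ← ∈-map⁻ (0ℤ ∷_) r = inj₂ (inj₁ (refl , ∈-++⁺ˡ β∈))
  ...   | inj₂ (here refl) = inj₂ (inj₂ (refl , refl))
  ...   | inj₂ (there r) with β , β∈ , refl ← ∈-map⁻ (0ℤ ∷_) r =
    inj₂ (inj₁ (refl , ∈-++⁺ʳ (shortRoots n) β∈))

  positiveRoots-suc⁺₀ : ∀ {β} → β ∈ positiveRoots n → 0ℤ ∷ β ∈ positiveRoots (suc n)
  positiveRoots-suc⁺₀ {β} p = subst (λ R → 0ℤ ∷ β ∈ R) (sym (positiveRoots-suc n))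
    (∈-++⁺ʳ (map (1ℤ ∷_) (V n)) (aux (∈-++⁻ (shortRoots n) p)))
    where
    aux : ∀ {β} → β ∈ shortRoots n ⊎ β ∈ longRoots n → 0ℤ ∷ β ∈ R′
    aux (inj₁ q) = ∈-++⁺ˡ (∈-map⁺ (0ℤ ∷_) q)
    aux (inj₂ q) = ∈-++⁺ʳ (map (0ℤ ∷_) (shortRoots n)) (there (∈-map⁺ (0ℤ ∷_) q))

  positiveRoots-suc⁺₁ : ∀ {β} → β ∈ V n → 1ℤ ∷ β ∈ positiveRoots (suc n)
  positiveRoots-suc⁺₁ {β} p = subst (λ R → 1ℤ ∷ β ∈ R) (sym (positiveRoots-suc n)) (∈-++⁺ˡ (∈-map⁺ (1ℤ ∷_) p))

  positiveRoots-suc⁺₂ : + 2 ∷ 0ʷ ∈ positiveRoots (suc n)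
  positiveRoots-suc⁺₂ = subst (λ R → + 2 ∷ 0ʷ ∈ R) (sym (positiveRoots-suc n))
    (∈-++⁺ʳ (map (1ℤ ∷_) (V n)) (∈-++⁺ʳ (map (0ℤ ∷_) (shortRoots n)) (here refl)))

sgn : Sign → ℤ
sgn s = signed s 1ℤ

-- Meant for roots, where not being positive means being negative. The product of
-- `polarity n (σ · α)` over the positive roots α is the sign of σ.
polarity : ∀ n → Weight n → ℤ
polarity n β = if does (β ∈? positiveRoots n) then 1ℤ else -1ℤ

polarity-∈ : ∀ {n} {β : Weight n} → β ∈ positiveRoots n → polarity n β ≡ 1ℤ
polarity-∈ {n} {β} p = cong (if_then 1ℤ else -1ℤ) (dec-true (β ∈? positiveRoots n) p)

polarity-∉ : ∀ {n} {β : Weight n} → ¬ β ∈ positiveRoots n → polarity n β ≡ -1ℤ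
polarity-∉ {n} {β} p = cong (if_then 1ℤ else -1ℤ) (dec-false (β ∈? positiveRoots n) p)

polarity-0 : ∀ {n} (β : Weight n) → polarity (suc n) (0ℤ ∷ β) ≡ polarity n β
polarity-0 {n} β with β ∈? positiveRoots n
... | yes p = polarity-∈ {β = 0ℤ ∷ β} (positiveRoots-suc⁺₀ p)
... | no ¬p = polarity-∉ {β = 0ℤ ∷ β} λ q → aux (positiveRoots-suc⁻ q)
  where
  aux : ¬ ((0ℤ ≡ 1ℤ × β ∈ V n) ⊎ (0ℤ ≡ 0ℤ × β ∈ positiveRoots n) ⊎ (0ℤ ≡ + 2 × β ≡ 0ʷ))
  aux (inj₂ (inj₁ (_ , q))) = ¬p q
  aux (inj₁ (() , _))
  aux (inj₂ (inj₂ (() , _)))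

polarity-neg : ∀ {n} m (β : Weight n) → polarity (suc n) (-[1+ m ] ∷ β) ≡ -1ℤ
polarity-neg m β = polarity-∉ {β = -[1+ m ] ∷ β} λ q → aux (positiveRoots-suc⁻ q)
  where
  aux : ¬ ((-[1+ m ] ≡ 1ℤ × _) ⊎ (-[1+ m ] ≡ 0ℤ × _) ⊎ (-[1+ m ] ≡ + 2 × _))
  aux (inj₂ (inj₁ (() , _)))
  aux (inj₁ (() , _))
  aux (inj₂ (inj₂ (() , _)))

polarity-signed₁ : ∀ {n} s {v : Weight n} → v ∈ V n → polarity (suc n) (signed s 1ℤ ∷ v) ≡ sgn s
polarity-signed₁ Sign.+ {v} v∈ = polarity-∈ {β = 1ℤ ∷ v} (positiveRoots-suc⁺₁ v∈)
polarity-signed₁ Sign.- {v} v∈ = polarity-neg 0 v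

polarity-signed₋₁ : ∀ {n} s {v : Weight n} → v ∈ V n → polarity (suc n) (signed s -1ℤ ∷ v) ≡ - sgn s
polarity-signed₋₁ Sign.- {v} v∈ = polarity-∈ {β = 1ℤ ∷ v} (positiveRoots-suc⁺₁ v∈)
polarity-signed₋₁ Sign.+ {v} v∈ = polarity-neg 0 v

polarity-signed₂ : ∀ {n} s → polarity (suc n) (signed s (+ 2) ∷ 0ʷ) ≡ sgn s
polarity-signed₂ {n} Sign.+ = polarity-∈ (positiveRoots-suc⁺₂ {n})
polarity-signed₂ {n} Sign.- = polarity-neg {n} 1 0ʷ

sgn-sgn : ∀ s → sgn s * sgn s ≡ 1ℤ
sgn-sgn Sign.+ = refl
sgn-sgn Sign.- = refl

-- The factors come in pairs, one for ε_b and one for -ε_b, so the sign occurs an even number of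
-- times.
∏-sgn-V : ∀ n s {f : Weight n → ℤ} → (∀ {v} → v ∈ V n → f v ≡ sgn s) → ∏ (V n) f ≡ 1ℤ
∏-sgn-V zero    s f≡ = refl
∏-sgn-V (suc n) s {f} f≡ = begin
  f (1ℤ ∷ 0ʷ) * (f (-1ℤ ∷ 0ʷ) * ∏ (map (0ℤ ∷_) (V n)) f)
    ≡⟨ cong₂ _*_ (f≡ (here refl)) (cong₂ _*_ (f≡ (there (here refl)))
         (trans (∏-map (V n) (0ℤ ∷_) f) (∏-sgn-V n s λ v∈ → f≡ (there (there (∈-map⁺ (0ℤ ∷_) v∈)))))) ⟩
  sgn s * (sgn s * 1ℤ)
    ≡⟨ cong (sgn s *_) (*-identityʳ _) ⟩
  sgn s * sgn s
    ≡⟨ sgn-sgn s ⟩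
  1ℤ ∎
  where open ≡-Reasoning

removeAt-0ʷ : ∀ {n} (j : Fin (suc n)) → removeAt 0ʷ j ≡ 0ʷ
removeAt-0ʷ Fin.zero            = refl
removeAt-0ʷ {suc n} (Fin.suc j) = cong (0ℤ ∷_) (removeAt-0ʷ j)

-- Only ±ε_j are nonzero at position j. Removing that position turns these two into zero and the
-- others into the weights of rank n; the two exceptional factors are moved to the front.
∏-V-removeAt : ∀ n (j : Fin (suc n)) (G : ℤ → Weight n → ℤ) →
  ∏ (V (suc n)) (λ v → G (lookup v j) (removeAt v j)) ≡ G 1ℤ 0ʷ * (G -1ℤ 0ʷ * ∏ (V n) (G 0ℤ))
∏-V-removeAt n       Fin.zero    G = cong (λ x → G 1ℤ 0ʷ * (G -1ℤ 0ʷ * x))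
  (∏-map (V n) (0ℤ ∷_) (λ v → G (lookup v Fin.zero) (removeAt v Fin.zero)))
∏-V-removeAt (suc n) (Fin.suc j) G = begin
  F (1ℤ ∷ 0ʷ) * (F (-1ℤ ∷ 0ʷ) * ∏ (map (0ℤ ∷_) (V (suc n))) F)
    ≡⟨ cong₂ (λ x y → x * (y * ∏ (map (0ℤ ∷_) (V (suc n))) F)) (zeros 1ℤ) (zeros -1ℤ) ⟩
  G 0ℤ (1ℤ ∷ 0ʷ) * (G 0ℤ (-1ℤ ∷ 0ʷ) * ∏ (map (0ℤ ∷_) (V (suc n))) F)
    ≡⟨ cong (λ x → G 0ℤ (1ℤ ∷ 0ʷ) * (G 0ℤ (-1ℤ ∷ 0ʷ) * x)) (begin
      ∏ (map (0ℤ ∷_) (V (suc n))) F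
        ≡⟨ ∏-map (V (suc n)) (0ℤ ∷_) F ⟩
      ∏ (V (suc n)) (F ∘ (0ℤ ∷_))
        ≡⟨ ∏-cong (V (suc n)) {F ∘ (0ℤ ∷_)} {λ v → G (lookup v j) (0ℤ ∷ removeAt v j)} (λ { (x ∷ v) → refl }) ⟩
      ∏ (V (suc n)) (λ v → G (lookup v j) (0ℤ ∷ removeAt v j))
        ≡⟨ ∏-V-removeAt n j (λ x v → G x (0ℤ ∷ v)) ⟩
      G 1ℤ 0ʷ * (G -1ℤ 0ʷ * ∏ (V n) (G 0ℤ ∘ (0ℤ ∷_))) ∎) ⟩
  G 0ℤ (1ℤ ∷ 0ʷ) * (G 0ℤ (-1ℤ ∷ 0ʷ) * (G 1ℤ 0ʷ * (G -1ℤ 0ʷ * ∏ (V n) (G 0ℤ ∘ (0ℤ ∷_)))))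
    ≡⟨ lemma (G 0ℤ (1ℤ ∷ 0ʷ)) (G 0ℤ (-1ℤ ∷ 0ʷ)) (G 1ℤ 0ʷ) (G -1ℤ 0ʷ) _ ⟩
  G 1ℤ 0ʷ * (G -1ℤ 0ʷ * (G 0ℤ (1ℤ ∷ 0ʷ) * (G 0ℤ (-1ℤ ∷ 0ʷ) * ∏ (V n) (G 0ℤ ∘ (0ℤ ∷_)))))
    ≡⟨ cong (λ x → G 1ℤ 0ʷ * (G -1ℤ 0ʷ * (G 0ℤ (1ℤ ∷ 0ʷ) * (G 0ℤ (-1ℤ ∷ 0ʷ) * x)))) (∏-map (V n) (0ℤ ∷_) (G 0ℤ)) ⟨
  G 1ℤ 0ʷ * (G -1ℤ 0ʷ * ∏ (V (suc n)) (G 0ℤ)) ∎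
  where
  open ≡-Reasoning
  F : Weight (suc (suc n)) → ℤ
  F v = G (lookup v (Fin.suc j)) (removeAt v (Fin.suc j))
  zeros : ∀ x → F (x ∷ 0ʷ) ≡ G 0ℤ (x ∷ 0ʷ)
  zeros x = cong₂ (λ y v → G y (x ∷ v)) (Vecₚ.lookup-replicate j 0ℤ) (removeAt-0ʷ j)
  lemma : ∀ a b c d e → a * (b * (c * (d * e))) ≡ c * (d * (a * (b * e)))
  lemma = solve-∀

-- The roots involving position j: each pair ε_a ± ε_j with a < j contributes
-- −1, each pair ε_j ± ε_b with j < b contributes +1, and 2 ε_j contributes
-- the sign s.
∏-positiveRoots-removeAt : ∀ n (j : Fin (suc n)) s (G : ℤ → Weight n → ℤ) →
  (∀ {v} → v ∈ V n → G 1ℤ v ≡ sgn s) → (∀ {v} → v ∈ V n → G -1ℤ v ≡ - sgn s) → G (+ 2) 0ʷ ≡ sgn s →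
  ∏ (positiveRoots (suc n)) (λ α → G (lookup α j) (removeAt α j)) ≡
  -1ℤ ^ toℕ j * sgn s * ∏ (positiveRoots n) (G 0ℤ)
∏-positiveRoots-removeAt n Fin.zero s G G₁ G₋₁ G₂ = begin
  ∏ (positiveRoots (suc n)) F
    ≡⟨ ∏-positiveRoots-suc n F ⟩
  ∏ (V n) (G 1ℤ) * (∏ (positiveRoots n) (G 0ℤ) * G (+ 2) 0ʷ)
    ≡⟨ cong₂ (λ x y → x * (∏ (positiveRoots n) (G 0ℤ) * y)) (∏-sgn-V n s G₁) G₂ ⟩
  1ℤ * (∏ (positiveRoots n) (G 0ℤ) * sgn s)
    ≡⟨ lemma (∏ (positiveRoots n) (G 0ℤ)) (sgn s) ⟩
  1ℤ * sgn s * ∏ (positiveRoots n) (G 0ℤ) ∎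
  where
  open ≡-Reasoning
  F : Weight (suc n) → ℤ
  F α = G (lookup α Fin.zero) (removeAt α Fin.zero)
  lemma : ∀ p t → 1ℤ * (p * t) ≡ 1ℤ * t * p
  lemma = solve-∀
∏-positiveRoots-removeAt (suc n) (Fin.suc j) s G G₁ G₋₁ G₂ = begin
  ∏ (positiveRoots (suc (suc n))) F
    ≡⟨ ∏-positiveRoots-suc (suc n) F ⟩
  ∏ (V (suc n)) (F ∘ (1ℤ ∷_)) * (∏ (positiveRoots (suc n)) (F ∘ (0ℤ ∷_)) * F (+ 2 ∷ 0ʷ))
    ≡⟨ cong₂ _*_ V-part (cong₂ _*_ R-part 2-part) ⟩
  -- The two roots formed from position 0 and the chosen position get opposite signs; their product
  -- is the additional factor -1 in passing from j to `Fin.suc j`.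
  sgn s * (- sgn s * v) * (-1ℤ ^ toℕ j * sgn s * r * t)
    ≡⟨ lemma (sgn s) v (-1ℤ ^ toℕ j) r t ⟩
  sgn s * sgn s * (-1ℤ ^ toℕ (Fin.suc j) * sgn s * (v * (r * t)))
    ≡⟨ cong₂ _*_ (sgn-sgn s) (cong (-1ℤ ^ toℕ (Fin.suc j) * sgn s *_) (sym (∏-positiveRoots-suc n (G 0ℤ)))) ⟩
  1ℤ * (-1ℤ ^ toℕ (Fin.suc j) * sgn s * ∏ (positiveRoots (suc n)) (G 0ℤ))
    ≡⟨ *-identityˡ _ ⟩
  -1ℤ ^ toℕ (Fin.suc j) * sgn s * ∏ (positiveRoots (suc n)) (G 0ℤ) ∎
  where
  open ≡-Reasoning
  F : Weight (suc (suc n)) → ℤ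
  F α = G (lookup α (Fin.suc j)) (removeAt α (Fin.suc j))
  v = ∏ (V n) (G 0ℤ ∘ (1ℤ ∷_))
  r = ∏ (positiveRoots n) (G 0ℤ ∘ (0ℤ ∷_))
  t = G 0ℤ (+ 2 ∷ 0ʷ)
  V-part : ∏ (V (suc n)) (F ∘ (1ℤ ∷_)) ≡ sgn s * (- sgn s * v)
  V-part = begin
    ∏ (V (suc n)) (F ∘ (1ℤ ∷_))
      ≡⟨ ∏-cong (V (suc n)) {F ∘ (1ℤ ∷_)} {λ v → G (lookup v j) (1ℤ ∷ removeAt v j)} (λ { (x ∷ v) → refl }) ⟩
    ∏ (V (suc n)) (λ v → G (lookup v j) (1ℤ ∷ removeAt v j))
      ≡⟨ ∏-V-removeAt n j (λ x v → G x (1ℤ ∷ v)) ⟩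
    G 1ℤ (1ℤ ∷ 0ʷ) * (G -1ℤ (1ℤ ∷ 0ʷ) * v)
      ≡⟨ cong₂ (λ x y → x * (y * v)) (G₁ (here refl)) (G₋₁ (here refl)) ⟩
    sgn s * (- sgn s * v) ∎
  R-part : ∏ (positiveRoots (suc n)) (F ∘ (0ℤ ∷_)) ≡ -1ℤ ^ toℕ j * sgn s * r
  R-part = trans (∏-cong (positiveRoots (suc n)) {F ∘ (0ℤ ∷_)} {λ α → G (lookup α j) (0ℤ ∷ removeAt α j)} (λ { (x ∷ α) → refl }))
    (∏-positiveRoots-removeAt n j s (λ x v → G x (0ℤ ∷ v))
      (λ v∈ → G₁ (there (there (∈-map⁺ (0ℤ ∷_) v∈)))) (λ v∈ → G₋₁ (there (there (∈-map⁺ (0ℤ ∷_) v∈)))) G₂)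
  2-part : F (+ 2 ∷ 0ʷ) ≡ t
  2-part = cong₂ (λ y v → G y (+ 2 ∷ v)) (Vecₚ.lookup-replicate j 0ℤ) (removeAt-0ʷ j)
  lemma : ∀ s v p r t → s * (- s * v) * (p * s * r * t) ≡ s * s * ((- 1ℤ) * p * s * (v * (r * t)))
  lemma = solve-∀

if-not-const : ∀ b → (if not b then -1ℤ else 1ℤ) ≡ (if b then 1ℤ else -1ℤ)
if-not-const true  = refl
if-not-const false = refl

-1^length-filter : ∀ {A : Set} {P : A → Set} (P? : ∀ x → Dec (P x)) xs →
  -1ℤ ^ length (filter P? xs) ≡ ∏ xs (λ x → if does (P? x) then -1ℤ else 1ℤ)
-1^length-filter P? []       = refl
-1^length-filter P? (x ∷ xs) with does (P? x)
... | true  = cong (-1ℤ *_) (-1^length-filter P? xs)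
... | false = trans (-1^length-filter P? xs) (sym (*-identityˡ _))

-1^ℓ : ∀ {n} (σ : SignedPermutation n) → -1ℤ ^ ℓ σ ≡ ∏ (positiveRoots n) (λ α → polarity n (σ · α))
-1^ℓ {n} σ = trans (-1^length-filter (λ α → ¬? (σ · α ∈? positiveRoots n)) (positiveRoots n))
  (∏-cong (positiveRoots n) (λ α → if-not-const (does (σ · α ∈? positiveRoots n))))

-- The action of signed permutations on coordinates

signed-0 : ∀ s → signed s 0ℤ ≡ 0ℤ
signed-0 Sign.+ = refl
signed-0 Sign.- = refl

tabulate-0ʷ : ∀ n → tabulate {n = n} (λ _ → 0ℤ) ≡ 0ʷ
tabulate-0ʷ zero    = refl
tabulate-0ʷ (suc n) = cong (0ℤ ∷_) (tabulate-0ʷ n)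

·-0ʷ : ∀ {n} (σ : SignedPermutation n) → σ · 0ʷ ≡ 0ʷ
·-0ʷ {n} (π , s) = trans (Vecₚ.tabulate-cong λ a →
    trans (cong (signed (lookup s a)) (Vecₚ.lookup-replicate (π ⟨$⟩ʳ a) 0ℤ)) (signed-0 (lookup s a)))
  (tabulate-0ʷ n)

lookup-removeAt : ∀ {n} (v : Weight (suc n)) j i → lookup v (punchIn j i) ≡ lookup (removeAt v j) i
lookup-removeAt (x ∷ v)     Fin.zero    i           = refl
lookup-removeAt (x ∷ y ∷ v) (Fin.suc j) Fin.zero    = refl
lookup-removeAt (x ∷ y ∷ v) (Fin.suc j) (Fin.suc i) = lookup-removeAt (y ∷ v) j i

insert-· : ∀ {n} j (π : Permutation′ n) s₀ s (v : Weight (suc n)) →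
  (insert Fin.zero j π , s₀ ∷ s) · v ≡ signed s₀ (lookup v j) ∷ (π , s) · removeAt v j
insert-· j π s₀ s v = cong (signed s₀ (lookup v j) ∷_) (Vecₚ.tabulate-cong λ a →
  cong (signed (lookup s a)) (lookup-removeAt v j (π ⟨$⟩ʳ a)))

∈-V⁺ : ∀ {n} s (a : Fin n) → 0ʷ [ a ]≔ sgn s ∈ V n
∈-V⁺ Sign.+ Fin.zero    = here refl
∈-V⁺ Sign.- Fin.zero    = there (here refl)
∈-V⁺ s      (Fin.suc a) = there (there (∈-map⁺ (0ℤ ∷_) (∈-V⁺ s a)))

∈-V⁻ : ∀ {n} {v : Weight n} → v ∈ V n → ∃ λ s → ∃ λ a → v ≡ 0ʷ [ a ]≔ sgn s
∈-V⁻ {suc n} (here refl)         = Sign.+ , Fin.zero , refl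
∈-V⁻ {suc n} (there (here refl)) = Sign.- , Fin.zero , refl
∈-V⁻ {suc n} (there (there p)) with u , u∈ , refl ← ∈-map⁻ (0ℤ ∷_) p
  with s , a , refl ← ∈-V⁻ u∈ = s , Fin.suc a , refl

tabulate-single : ∀ {n} (a : Fin n) x (f : Fin n → ℤ) → f a ≡ x → (∀ b → b ≢ a → f b ≡ 0ℤ) →
  tabulate f ≡ 0ʷ [ a ]≔ x
tabulate-single {suc n} Fin.zero x f fa f≡0 = cong₂ _∷_ fa
  (trans (Vecₚ.tabulate-cong (λ b → f≡0 (Fin.suc b) λ ())) (tabulate-0ʷ n))
tabulate-single (Fin.suc a) x f fa f≡0 = cong₂ _∷_ (f≡0 Fin.zero λ ())
  (tabulate-single a x (f ∘ Fin.suc) fa λ b b≢a → f≡0 (Fin.suc b) λ { refl → b≢a refl })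

signed-sgn : ∀ s t → ∃ λ u → signed s (sgn t) ≡ sgn u
signed-sgn Sign.+ t      = t , refl
signed-sgn Sign.- Sign.+ = Sign.- , refl
signed-sgn Sign.- Sign.- = Sign.+ , refl

-- The action reads v at π a, so the only nonzero entry of v, at b, reappears with a sign at π⁻¹ b.
·-V : ∀ {n} (σ : SignedPermutation n) {v : Weight n} → v ∈ V n → σ · v ∈ V n
·-V {n} (π , s) v∈ with t , b , refl ← ∈-V⁻ v∈ =
  subst (λ w → w ∈ V n)
    (sym (tabulate-single a (sgn u) _
      (trans (cong (signed (lookup s a))
        (trans (cong (lookup (0ʷ [ b ]≔ sgn t)) (inverseʳ π)) (Vecₚ.lookup∘update b 0ʷ (sgn t)))) u≡)
      (λ c c≢a → trans (cong (signed (lookup s c))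
        (trans (Vecₚ.lookup∘update′ (λ πc≡b → c≢a (trans (sym (inverseˡ π)) (cong (π ⟨$⟩ˡ_) πc≡b))) 0ʷ (sgn t))
               (Vecₚ.lookup-replicate (π ⟨$⟩ʳ c) 0ℤ)))
        (signed-0 (lookup s c)))))
    (∈-V⁺ u a)
  where
  a = π ⟨$⟩ˡ b
  u = proj₁ (signed-sgn (lookup s a) t)
  u≡ = proj₂ (signed-sgn (lookup s a) t)

-- Roots that do not involve position j behave as under (π , s) in rank n, while the others
-- contribute (-1)^j and the sign s₀. The result is the cofactor sign of an expansion along the
-- first coordinate.
-1^ℓ-insert : ∀ {n} j (π : Permutation′ n) s₀ s →
  -1ℤ ^ ℓ (insert Fin.zero j π , s₀ ∷ s) ≡ -1ℤ ^ toℕ j * sgn s₀ * -1ℤ ^ ℓ (π , s)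
-1^ℓ-insert {n} j π s₀ s = begin
  -1ℤ ^ ℓ σ′
    ≡⟨ -1^ℓ σ′ ⟩
  ∏ (positiveRoots (suc n)) (λ α → polarity (suc n) (σ′ · α))
    ≡⟨ ∏-cong (positiveRoots (suc n)) (λ α → cong (polarity (suc n)) (insert-· j π s₀ s α)) ⟩
  ∏ (positiveRoots (suc n)) (λ α → G (lookup α j) (removeAt α j))
    ≡⟨ ∏-positiveRoots-removeAt n j s₀ G
         (λ v∈ → polarity-signed₁ s₀ (·-V σ v∈))
         (λ v∈ → polarity-signed₋₁ s₀ (·-V σ v∈))
         (trans (cong (λ v → polarity (suc n) (signed s₀ (+ 2) ∷ v)) (·-0ʷ σ)) (polarity-signed₂ {n} s₀)) ⟩
  -1ℤ ^ toℕ j * sgn s₀ * ∏ (positiveRoots n) (G 0ℤ)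
    ≡⟨ cong (-1ℤ ^ toℕ j * sgn s₀ *_) (begin
      ∏ (positiveRoots n) (G 0ℤ)
        ≡⟨ ∏-cong (positiveRoots n) (λ α →
             trans (cong (λ x → polarity (suc n) (x ∷ σ · α)) (signed-0 s₀)) (polarity-0 (σ · α))) ⟩
      ∏ (positiveRoots n) (λ α → polarity n (σ · α))
        ≡⟨ -1^ℓ σ ⟨
      -1ℤ ^ ℓ σ ∎) ⟩
  -1ℤ ^ toℕ j * sgn s₀ * -1ℤ ^ ℓ σ ∎
  where
  open ≡-Reasoning
  σ  = π , s
  σ′ = insert Fin.zero j π , s₀ ∷ s
  G : ℤ → Weight n → ℤ
  G x v = polarity (suc n) (signed s₀ x ∷ σ · v)

-- Alternating sums over the Weyl group

-- As in the expansion of a determinant, g receives an entry and the vector without it. Recursion on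
-- the vector, in place of a sum over positions, makes it compute on vectors with a known beginning.
laplace : ∀ {n} → Weight (suc n) → (ℤ → Weight n → ℤ) → ℤ
laplace {zero}  (x ∷ []) g = g x []
laplace {suc n} (x ∷ xs) g = g x xs - laplace xs (λ y ys → g y (x ∷ ys))

-- By `∑-W` this is the alternating sum of F (σ · a) over `W n`: the first coordinate of σ · a is y
-- or -y for an entry y, and the remaining entries are permuted and signed in turn.
alt : ∀ {n} → Weight n → (Weight n → ℤ) → ℤ
alt {zero}  a F = F []
alt {suc n} a F = laplace a (λ y ys → alt ys (F ∘ (y ∷_)) - alt ys (F ∘ (- y ∷_)))

laplace-cong : ∀ {n} (a : Weight (suc n)) {g h : ℤ → Weight n → ℤ} → (∀ y ys → g y ys ≡ h y ys) →
  laplace a g ≡ laplace a h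
laplace-cong {zero}  (x ∷ []) g≗h = g≗h x []
laplace-cong {suc n} (x ∷ xs) g≗h = cong₂ _-_ (g≗h x xs) (laplace-cong xs (λ y ys → g≗h y (x ∷ ys)))

∑-laplace : ∀ {n} (a : Weight (suc n)) (g : ℤ → Weight n → ℤ) →
  ∑ (allFin (suc n)) (λ j → -1ℤ ^ toℕ j * g (lookup a j) (removeAt a j)) ≡ laplace a g
∑-laplace {zero}  (x ∷ []) g = trans (+-identityʳ _) (*-identityˡ _)
∑-laplace {suc n} a@(x ∷ xs@(_ ∷ _)) g = cong₂ _+_ (*-identityˡ (g x xs)) (begin
  ∑ (List.tabulate Fin.suc) f
    ≡⟨ cong (λ js → ∑ js f) (map-tabulate id Fin.suc) ⟨
  ∑ (map Fin.suc (allFin (suc n))) f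
    ≡⟨ ∑-map (allFin (suc n)) Fin.suc f ⟩
  ∑ (allFin (suc n)) (f ∘ Fin.suc)
    ≡⟨ ∑-cong (allFin (suc n)) (λ j → *-assoc -1ℤ (-1ℤ ^ toℕ j) (g (lookup xs j) (x ∷ removeAt xs j))) ⟩
  ∑ (allFin (suc n)) (λ j → -1ℤ * (-1ℤ ^ toℕ j * g (lookup xs j) (x ∷ removeAt xs j)))
    ≡⟨ ∑-* (allFin (suc n)) -1ℤ (λ j → -1ℤ ^ toℕ j * g (lookup xs j) (x ∷ removeAt xs j)) ⟩
  -1ℤ * ∑ (allFin (suc n)) (λ j → -1ℤ ^ toℕ j * g (lookup xs j) (x ∷ removeAt xs j))
    ≡⟨ cong (-1ℤ *_) (∑-laplace xs (λ y ys → g y (x ∷ ys))) ⟩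
  -1ℤ * laplace xs (λ y ys → g y (x ∷ ys))
    ≡⟨ -1*i≡-i _ ⟩
  - laplace xs (λ y ys → g y (x ∷ ys)) ∎)
  where
  open ≡-Reasoning
  f : Fin (suc (suc n)) → ℤ
  f j = -1ℤ ^ toℕ j * g (lookup a j) (removeAt a j)

-- The summands with π 0 = j form the j-th term of a Laplace expansion.
∑-W : ∀ n (a : Weight n) (F : Weight n → ℤ) → ∑ (W n) (λ σ → -1ℤ ^ ℓ σ * F (σ · a)) ≡ alt a F
∑-W zero    a F = trans (+-identityʳ _) (*-identityˡ _)
∑-W (suc n) a F = begin
  ∑ (W (suc n)) G
    ≡⟨ ∑-product _,_ (allPermutations (suc n)) (allSigns (suc n)) G ⟩
  ∑ (allPermutations (suc n)) (λ π → ∑ (allSigns (suc n)) (λ s → G (π , s)))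
    ≡⟨ ∑-product (insert Fin.zero) (allFin (suc n)) (allPermutations n) _ ⟩
  ∑ (allFin (suc n)) (λ j → ∑ (allPermutations n) (λ π → ∑ (allSigns (suc n)) (λ s → G (insert Fin.zero j π , s))))
    ≡⟨ ∑-cong (allFin (suc n)) summand ⟩
  ∑ (allFin (suc n)) (λ j → -1ℤ ^ toℕ j *
      (alt (removeAt a j) (F ∘ (lookup a j ∷_)) - alt (removeAt a j) (F ∘ (- lookup a j ∷_))))
    ≡⟨ ∑-laplace a (λ y ys → alt ys (F ∘ (y ∷_)) - alt ys (F ∘ (- y ∷_))) ⟩
  alt a F ∎
  where
  open ≡-Reasoning
  G : SignedPermutation (suc n) → ℤ
  G σ = -1ℤ ^ ℓ σ * F (σ · a)

  fixed-sign : ∀ j s₀ → ∑ (W n) (λ (π , s) → G (insert Fin.zero j π , s₀ ∷ s)) ≡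
    -1ℤ ^ toℕ j * sgn s₀ * alt (removeAt a j) (F ∘ (signed s₀ (lookup a j) ∷_))
  fixed-sign j s₀ = begin
    ∑ (W n) (λ (π , s) → G (insert Fin.zero j π , s₀ ∷ s))
      ≡⟨ ∑-cong (W n) (λ (π , s) → trans
           (cong₂ _*_ (-1^ℓ-insert j π s₀ s) (cong F (insert-· j π s₀ s a)))
           (*-assoc (-1ℤ ^ toℕ j * sgn s₀) (-1ℤ ^ ℓ (π , s)) _)) ⟩
    ∑ (W n) (λ σ → -1ℤ ^ toℕ j * sgn s₀ * (-1ℤ ^ ℓ σ * F (signed s₀ (lookup a j) ∷ σ · removeAt a j)))
      ≡⟨ ∑-* (W n) (-1ℤ ^ toℕ j * sgn s₀) _ ⟩
    -1ℤ ^ toℕ j * sgn s₀ * ∑ (W n) (λ σ → -1ℤ ^ ℓ σ * F (signed s₀ (lookup a j) ∷ σ · removeAt a j))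
      ≡⟨ cong (-1ℤ ^ toℕ j * sgn s₀ *_) (∑-W n (removeAt a j) (F ∘ (signed s₀ (lookup a j) ∷_))) ⟩
    _ ∎

  lemma : ∀ p x y → p * 1ℤ * x + p * -1ℤ * y ≡ p * (x - y)
  lemma = solve-∀

  summand : ∀ j → ∑ (allPermutations n) (λ π → ∑ (allSigns (suc n)) (λ s → G (insert Fin.zero j π , s))) ≡
    -1ℤ ^ toℕ j * (alt (removeAt a j) (F ∘ (lookup a j ∷_)) - alt (removeAt a j) (F ∘ (- lookup a j ∷_)))
  summand j = begin
    ∑ (allPermutations n) (λ π → ∑ (allSigns (suc n)) (λ s → G (insert Fin.zero j π , s)))
      ≡⟨ ∑-cong (allPermutations n) (λ π → trans
           (∑-product _∷_ (Sign.+ ∷ Sign.- ∷ []) (allSigns n) (λ s → G (insert Fin.zero j π , s)))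
           (cong (_+_ (∑ (allSigns n) (λ s → G (insert Fin.zero j π , Sign.+ ∷ s)))) (+-identityʳ _))) ⟩
    ∑ (allPermutations n) (λ π → ∑ (allSigns n) (λ s → G (insert Fin.zero j π , Sign.+ ∷ s))
                               + ∑ (allSigns n) (λ s → G (insert Fin.zero j π , Sign.- ∷ s)))
      ≡⟨ ∑-+ (allPermutations n) _ _ ⟩
    ∑ (allPermutations n) (λ π → ∑ (allSigns n) (λ s → G (insert Fin.zero j π , Sign.+ ∷ s))) +
    ∑ (allPermutations n) (λ π → ∑ (allSigns n) (λ s → G (insert Fin.zero j π , Sign.- ∷ s)))
      ≡⟨ cong₂ _+_ (∑-product _,_ (allPermutations n) (allSigns n) _)
                   (∑-product _,_ (allPermutations n) (allSigns n) _) ⟨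
    ∑ (W n) (λ (π , s) → G (insert Fin.zero j π , Sign.+ ∷ s)) +
    ∑ (W n) (λ (π , s) → G (insert Fin.zero j π , Sign.- ∷ s))
      ≡⟨ cong₂ _+_ (fixed-sign j Sign.+) (fixed-sign j Sign.-) ⟩
    -1ℤ ^ toℕ j * 1ℤ * alt (removeAt a j) (F ∘ (lookup a j ∷_)) +
    -1ℤ ^ toℕ j * -1ℤ * alt (removeAt a j) (F ∘ (- lookup a j ∷_))
      ≡⟨ lemma (-1ℤ ^ toℕ j) _ _ ⟩
    _ ∎

-- Multiplication by q
↑ : Series → Series
↑ f zero    = 0ℤ
↑ f (suc k) = f k

↑-cong : ∀ {f g} → f ≈ g → ↑ f ≈ ↑ g
↑-cong f≈g zero    = refl
↑-cong f≈g (suc k) = f≈g k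

-- Unordered pairs with repetition, each taken once in list order: the ways to choose two factors
-- out of a product of geometric series.
∑≤ : ∀ {A : Set} → List A → (A → A → ℤ) → ℤ
∑≤ []       f = 0ℤ
∑≤ (x ∷ xs) f = ∑ (x ∷ xs) (f x) + ∑≤ xs f

∑≤-cong : ∀ {A : Set} (xs : List A) {f g : A → A → ℤ} → (∀ x y → f x y ≡ g x y) → ∑≤ xs f ≡ ∑≤ xs g
∑≤-cong []       f≗g = refl
∑≤-cong (x ∷ xs) f≗g = cong₂ _+_ (∑-cong (x ∷ xs) (f≗g x)) (∑≤-cong xs f≗g)

∑≤-map : ∀ {A B : Set} (xs : List A) (h : A → B) (f : B → B → ℤ) →
  ∑≤ (map h xs) f ≡ ∑≤ xs (λ x y → f (h x) (h y))
∑≤-map []       h f = refl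
∑≤-map (x ∷ xs) h f = cong₂ _+_ (∑-map (x ∷ xs) h (f (h x))) (∑≤-map xs h f)

-- Division of weight series by 1 - q x^α

module _ {n : ℕ} where

  divides : List (Weight n) → WeightSeries n → WeightSeries n
  divides αs G = foldr divide G αs

  divide-cong : ∀ α {G H : WeightSeries n} → (∀ k β → G k β ≡ H k β) → ∀ k β → divide α G k β ≡ divide α H k β
  divide-cong α G≗H zero    β = G≗H zero β
  divide-cong α G≗H (suc k) β = cong₂ _+_ (G≗H (suc k) β) (divide-cong α G≗H k (β -ʷ α))

  divides-cong : ∀ αs {G H : WeightSeries n} → (∀ k β → G k β ≡ H k β) →
    ∀ k β → divides αs G k β ≡ divides αs H k β
  divides-cong []       G≗H = G≗H
  divides-cong (α ∷ αs) G≗H = divide-cong α (divides-cong αs G≗H)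

  -- `divide α G` at β evaluates G only at β, β - α, β - 2α, ..., all of which lie in S.
  divide-vanish : ∀ (S : Weight n → Set) α {G : WeightSeries n} → (∀ {β} → S β → S (β -ʷ α)) →
    (∀ k {β} → S β → G k β ≡ 0ℤ) → ∀ k {β} → S β → divide α G k β ≡ 0ℤ
  divide-vanish S α closed G≡0 zero    β∈S = G≡0 zero β∈S
  divide-vanish S α closed G≡0 (suc k) β∈S =
    cong₂ _+_ (G≡0 (suc k) β∈S) (divide-vanish S α closed G≡0 k (closed β∈S))

  divides-vanish : ∀ (S : Weight n → Set) αs {G : WeightSeries n} → (∀ {α β} → α ∈ αs → S β → S (β -ʷ α)) →
    (∀ k {β} → S β → G k β ≡ 0ℤ) → ∀ k {β} → S β → divides αs G k β ≡ 0ℤ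
  divides-vanish S []       closed G≡0 = G≡0
  divides-vanish S (α ∷ αs) closed G≡0 =
    divide-vanish S α (closed (here refl)) (divides-vanish S αs (closed ∘ there) G≡0)

  shift : WeightSeries n → WeightSeries n
  shift G k β = ↑ (λ i → G i β) k

  divide-shift : ∀ α (G : WeightSeries n) k β → divide α (shift G) k β ≡ shift (divide α G) k β
  divide-shift α G zero          β = refl
  divide-shift α G (suc zero)    β = +-identityʳ (G zero β)
  divide-shift α G (suc (suc k)) β = cong (_+_ (G (suc k) β)) (divide-shift α G (suc k) (β -ʷ α))

  divides-shift : ∀ αs (G : WeightSeries n) k β → divides αs (shift G) k β ≡ shift (divides αs G) k β
  divides-shift []       G k β = refl
  divides-shift (α ∷ αs) G k β =
    trans (divide-cong α (divides-shift αs G) k β) (divide-shift α (divides αs G) k β)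

  slice : ℤ → WeightSeries (suc n) → WeightSeries n
  slice c G k γ = G k (c ∷ γ)

divide-0∷ : ∀ {n} (α : Weight n) G c k γ → divide (0ℤ ∷ α) G k (c ∷ γ) ≡ divide α (slice c G) k γ
divide-0∷ α G c zero    γ = refl
divide-0∷ α G c (suc k) γ = cong (_+_ (G (suc k) (c ∷ γ)))
  (trans (cong (λ x → divide (0ℤ ∷ α) G k (x ∷ γ -ʷ α)) (+-identityʳ c)) (divide-0∷ α G c k (γ -ʷ α)))

divides-0∷ : ∀ {n} (αs : List (Weight n)) G c k γ →
  divides (map (0ℤ ∷_) αs) G k (c ∷ γ) ≡ divides αs (slice c G) k γ
divides-0∷ []       G c k γ = refl
divides-0∷ (α ∷ αs) G c k γ =
  trans (divide-0∷ α (divides (map (0ℤ ∷_) αs) G) c k γ) (divide-cong α (divides-0∷ αs G c) k γ)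

-- Positive roots have nonnegative first coordinate, so subtracting them never leaves this set. It
-- cuts off the recursion of `divide` below first coordinate zero.
data NegativeHead {n} : Weight (suc n) → Set where
  neg : ∀ {m γ} → NegativeHead (-[1+ m ] ∷ γ)

neg-minus-nonNeg : ∀ {n m} (β : Weight (suc n)) (v : Weight n) → NegativeHead β → NegativeHead (β -ʷ (+ m ∷ v))
neg-minus-nonNeg {m = zero}  _ v neg = neg
neg-minus-nonNeg {m = suc m} _ v neg = neg

-- The factor for 2ε₀ adds q times the coefficient two steps lower in the first coordinate, so of
-- the slices 0, 1 and 2 only the last changes. The hypotheses hold for a series supported on first
-- coordinate zero.
divide-2∷ : ∀ {n} (G : WeightSeries (suc n)) →
  (∀ k γ → slice 1ℤ G k γ ≡ 0ℤ) → (∀ k γ → slice (+ 2) G k γ ≡ 0ℤ) → (∀ k {β} → NegativeHead β → G k β ≡ 0ℤ) →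
  let F = divide (+ 2 ∷ 0ʷ) G in
  (∀ k γ → slice 0ℤ F k γ ≡ slice 0ℤ G k γ) ×
  (∀ k γ → slice 1ℤ F k γ ≡ 0ℤ) ×
  (∀ k γ → slice (+ 2) F k γ ≡ shift (slice 0ℤ G) k γ) ×
  (∀ k {β} → NegativeHead β → F k β ≡ 0ℤ)
divide-2∷ {n} G G₁ G₂ G₋ = slice₀ , slice₁ , slice₂ , F₋
  where
  F = divide (+ 2 ∷ 0ʷ) G

  F₋ : ∀ k {β} → NegativeHead β → F k β ≡ 0ℤ
  F₋ = divide-vanish NegativeHead (+ 2 ∷ 0ʷ) {G} (λ {β} → neg-minus-nonNeg β 0ʷ) G₋

  slice₀ : ∀ k γ → slice 0ℤ F k γ ≡ slice 0ℤ G k γ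
  slice₀ zero    γ = refl
  slice₀ (suc k) γ = trans (cong (_+_ (G (suc k) (0ℤ ∷ γ))) (F₋ k neg)) (+-identityʳ _)

  slice₁ : ∀ k γ → slice 1ℤ F k γ ≡ 0ℤ
  slice₁ zero    γ = G₁ zero γ
  slice₁ (suc k) γ = cong₂ _+_ (G₁ (suc k) γ) (F₋ k neg)

  slice₂ : ∀ k γ → slice (+ 2) F k γ ≡ shift (slice 0ℤ G) k γ
  slice₂ zero    γ = G₂ zero γ
  slice₂ (suc k) γ = trans (cong₂ _+_ (G₂ (suc k) γ) (trans (cong (λ γ → F k (0ℤ ∷ γ)) (-ʷ-identityʳ γ)) (slice₀ k γ)))
                           (+-identityˡ _)

-- In the product of the series 1/(1 - q x₀ x^v), degree one in x₀ selects one v and degree two an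
-- unordered pair. As G has no slice 1, there are no mixed terms in degree two.
divides-1∷ : ∀ {n} (vs : List (Weight n)) (G : WeightSeries (suc n)) →
  (∀ k γ → slice 1ℤ G k γ ≡ 0ℤ) → (∀ k {β} → NegativeHead β → G k β ≡ 0ℤ) →
  let F = divides (map (1ℤ ∷_) vs) G in
  (∀ k γ → slice 0ℤ F k γ ≡ slice 0ℤ G k γ) ×
  (∀ k γ → slice 1ℤ F k γ ≡ ↑ (λ i → ∑ vs (λ v → slice 0ℤ G i (γ -ʷ v))) k) ×
  (∀ k γ → slice (+ 2) F k γ ≡
    slice (+ 2) G k γ + ↑ (↑ (λ i → ∑≤ vs (λ v w → slice 0ℤ G i (γ -ʷ v -ʷ w)))) k) ×
  (∀ k {β} → NegativeHead β → F k β ≡ 0ℤ)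
divides-1∷ {n} []       G G₁ G₋ =
  (λ k γ → refl) , (λ { zero γ → G₁ zero γ ; (suc k) γ → G₁ (suc k) γ }) ,
  (λ { zero γ → sym (+-identityʳ _) ; (suc zero) γ → sym (+-identityʳ _) ; (suc (suc k)) γ → sym (+-identityʳ _) }) ,
  G₋
divides-1∷ {n} (v ∷ vs) G G₁ G₋ with E₀ , E₁ , E₂ , E₋ ← divides-1∷ vs G G₁ G₋ = slice₀ , slice₁ , slice₂ , F₋
  where
  E = divides (map (1ℤ ∷_) vs) G
  F = divide (1ℤ ∷ v) E

  F₋ : ∀ k {β} → NegativeHead β → F k β ≡ 0ℤ
  F₋ = divide-vanish NegativeHead (1ℤ ∷ v) {E} (λ {β} → neg-minus-nonNeg β v) E₋

  slice₀ : ∀ k γ → slice 0ℤ F k γ ≡ slice 0ℤ G k γ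
  slice₀ zero    γ = E₀ zero γ
  slice₀ (suc k) γ = trans (cong₂ _+_ (E₀ (suc k) γ) (F₋ k neg)) (+-identityʳ _)

  slice₁ : ∀ k γ → slice 1ℤ F k γ ≡ ↑ (λ i → ∑ (v ∷ vs) (λ v → slice 0ℤ G i (γ -ʷ v))) k
  slice₁ zero    γ = E₁ zero γ
  slice₁ (suc k) γ = trans (cong₂ _+_ (E₁ (suc k) γ) (slice₀ k (γ -ʷ v)))
    (+-comm (∑ vs (λ v → slice 0ℤ G k (γ -ʷ v))) (slice 0ℤ G k (γ -ʷ v)))

  slice₂ : ∀ k γ → slice (+ 2) F k γ ≡
    slice (+ 2) G k γ + ↑ (↑ (λ i → ∑≤ (v ∷ vs) (λ v w → slice 0ℤ G i (γ -ʷ v -ʷ w)))) k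
  slice₂ zero          γ = E₂ zero γ
  slice₂ (suc zero)    γ = trans (cong₂ _+_ (E₂ 1 γ) (slice₁ 0 (γ -ʷ v))) (+-identityʳ _)
  -- One factor belongs to v and the other is taken from `v ∷ vs`, not from `vs`; this yields the
  -- pair (v , v).
  slice₂ (suc (suc k)) γ = trans (cong₂ _+_ (E₂ (suc (suc k)) γ) (slice₁ (suc k) (γ -ʷ v)))
    (lemma (slice (+ 2) G (suc (suc k)) γ) (∑≤ vs (λ v w → slice 0ℤ G k (γ -ʷ v -ʷ w)))
           (∑ (v ∷ vs) (λ w → slice 0ℤ G k (γ -ʷ v -ʷ w))))
    where
    lemma : ∀ a b c → a + b + c ≡ a + (c + b)
    lemma = solve-∀

one-≢0 : ∀ {n} {c} → c ≢ 0ℤ → ∀ k (γ : Weight n) → one k (c ∷ γ) ≡ 0ℤ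
one-≢0 {c = c} c≢0 k γ rewrite dec-false ((c ∷ γ) ≟ʷ 0ʷ) (λ { refl → c≢0 refl }) | ∧-zeroʳ (does (k ℕₚ.≟ 0)) = refl

divides-zero : ∀ {n} (αs : List (Weight n)) {G : WeightSeries n} → (∀ k β → G k β ≡ 0ℤ) →
  ∀ k β → divides αs G k β ≡ 0ℤ
-- The set of all weights, given by a predicate that is trivially true.
divides-zero αs G≡0 k β = divides-vanish (λ _ → β ≡ β) αs (λ _ _ → refl) (λ k {β} _ → G≡0 k β) k refl

-- The expansion of 𝒫 along the roots ε₀ ± ε_b and 2 ε₀.
module _ {n : ℕ} where
  private
    -- Partial products, built from the right of the list in `positiveRoots-suc`: long roots of rank
    -- n, then 2ε₀, then short roots of rank n. Only the factors for ε₀ ± ε_b are left.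
    L S F : WeightSeries (suc n)
    L = divides (map (0ℤ ∷_) (longRoots n)) one
    S = divide (+ 2 ∷ 0ʷ) L
    F = divides (map (0ℤ ∷_) (shortRoots n)) S

    𝒫≡ : ∀ k β → 𝒫 β k ≡ divides (map (1ℤ ∷_) (V n)) F k β
    𝒫≡ k β = begin
      divides (positiveRoots (suc n)) one k β
        ≡⟨ cong (λ αs → divides αs one k β) (positiveRoots-suc n) ⟩
      divides (map (1ℤ ∷_) (V n) ++ rest) one k β
        ≡⟨ cong (λ G → G k β) (foldr-++ divide one (map (1ℤ ∷_) (V n)) rest) ⟩
      divides (map (1ℤ ∷_) (V n)) (divides rest one) k β
        ≡⟨ cong (λ G → divides (map (1ℤ ∷_) (V n)) G k β) (foldr-++ divide one (map (0ℤ ∷_) (shortRoots n)) _) ⟩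
      divides (map (1ℤ ∷_) (V n)) F k β ∎
      where
      open ≡-Reasoning
      rest = map (0ℤ ∷_) (shortRoots n) ++ (+ 2 ∷ 0ʷ) ∷ map (0ℤ ∷_) (longRoots n)

    L≢0 : ∀ {c} → c ≢ 0ℤ → ∀ k γ → slice c L k γ ≡ 0ℤ
    L≢0 {c} c≢0 k γ = trans (divides-0∷ (longRoots n) one c k γ) (divides-zero (longRoots n) (one-≢0 c≢0) k γ)

    L₋ : ∀ k {β} → NegativeHead β → L k β ≡ 0ℤ
    L₋ k (neg {γ = γ}) = L≢0 (λ ()) k γ

    S-slices = divide-2∷ L (L≢0 λ ()) (L≢0 λ ()) L₋

    𝒫-divides : ∀ k γ → 𝒫 γ k ≡ divides (shortRoots n) (divides (longRoots n) one) k γ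
    𝒫-divides k γ = cong (λ G → G k γ) (foldr-++ divide one (shortRoots n) (longRoots n))

    F₀ : ∀ k γ → slice 0ℤ F k γ ≡ 𝒫 γ k
    F₀ k γ = trans (divides-0∷ (shortRoots n) S 0ℤ k γ)
      (trans (divides-cong (shortRoots n) (λ k γ →
        trans (proj₁ S-slices k γ) (divides-0∷ (longRoots n) one 0ℤ k γ)) k γ) (sym (𝒫-divides k γ)))

    F₁ : ∀ k γ → slice 1ℤ F k γ ≡ 0ℤ
    F₁ k γ = trans (divides-0∷ (shortRoots n) S 1ℤ k γ)
      (divides-zero (shortRoots n) (proj₁ (proj₂ S-slices)) k γ)

    F₂ : ∀ k γ → slice (+ 2) F k γ ≡ ↑ (𝒫 γ) k
    F₂ k γ = trans (divides-0∷ (shortRoots n) S (+ 2) k γ)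
      (trans (divides-cong (shortRoots n) (proj₁ (proj₂ (proj₂ S-slices))) k γ)
      (trans (divides-shift (shortRoots n) (slice 0ℤ L) k γ)
      (↑-cong (λ i → trans (divides-cong (shortRoots n) (divides-0∷ (longRoots n) one 0ℤ) i γ) (sym (𝒫-divides i γ))) k)))

    F₋ : ∀ k {β} → NegativeHead β → F k β ≡ 0ℤ
    F₋ k (neg {m} {γ}) = trans (divides-0∷ (shortRoots n) S -[1+ m ] k γ)
      (divides-zero (shortRoots n) (λ k γ → proj₂ (proj₂ (proj₂ S-slices)) k neg) k γ)

    slices = divides-1∷ (V n) F F₁ F₋

  𝒫-neg : ∀ m γ → 𝒫 { suc n } (-[1+ m ] ∷ γ) ≈ 𝟘
  𝒫-neg m γ k = trans (𝒫≡ k _) (proj₂ (proj₂ (proj₂ slices)) k neg)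

  𝒫-0 : ∀ (γ : Weight n) → 𝒫 (0ℤ ∷ γ) ≈ 𝒫 γ
  𝒫-0 γ k = trans (𝒫≡ k _) (trans (proj₁ slices k γ) (F₀ k γ))

  𝒫-1 : ∀ (γ : Weight n) → 𝒫 (1ℤ ∷ γ) ≈ ↑ (λ i → ∑ (V n) (λ v → 𝒫 (γ -ʷ v) i))
  𝒫-1 γ k = trans (𝒫≡ k _) (trans (proj₁ (proj₂ slices) k γ)
    (↑-cong (λ i → ∑-cong (V n) (λ v → F₀ i (γ -ʷ v))) k))

  -- A sum of positive roots with first coordinate 2 contains either 2ε₀, at the cost of one q, or
  -- two possibly equal roots ε₀ + v and ε₀ + w, at the cost of q².
  𝒫-2 : ∀ (γ : Weight n) k →
    𝒫 (+ 2 ∷ γ) k ≡ ↑ (𝒫 γ) k + ↑ (↑ (λ i → ∑≤ (V n) (λ v w → 𝒫 (γ -ʷ v -ʷ w) i))) k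
  𝒫-2 γ k = trans (𝒫≡ k _) (trans (proj₁ (proj₂ (proj₂ slices)) k γ)
    (cong₂ _+_ (F₂ k γ) (↑-cong (↑-cong (λ i → ∑≤-cong (V n) (λ v w → F₀ i (γ -ʷ v -ʷ w)))) k)))

-- Parity

-- The root lattice of type C consists of the integral weights with even coordinate sum.
total : ∀ {n} → Weight n → ℤ
total []      = 0ℤ
total (x ∷ v) = x + total v

Even Odd : ℤ → Set
Even z = ∃ λ w → z ≡ w + w
Odd  z = ∃ λ w → z ≡ 1ℤ + (w + w)

total-0ʷ : ∀ n → total (0ʷ {n}) ≡ 0ℤ
total-0ʷ zero    = refl
total-0ʷ (suc n) = trans (+-identityˡ _) (total-0ʷ n)

total-+ʷ : ∀ {n} (u v : Weight n) → total (u +ʷ v) ≡ total u + total v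
total-+ʷ []      []      = refl
total-+ʷ (x ∷ u) (y ∷ v) = trans (cong (_+_ (x + y)) (total-+ʷ u v)) (lemma x y (total u) (total v))
  where
  lemma : ∀ a b c d → a + b + (c + d) ≡ a + c + (b + d)
  lemma = solve-∀

total--ʷ : ∀ {n} (u v : Weight n) → total (u -ʷ v) ≡ total u - total v
total--ʷ []      []      = refl
total--ʷ (x ∷ u) (y ∷ v) = trans (cong (_+_ (x - y)) (total--ʷ u v)) (lemma x y (total u) (total v))
  where
  lemma : ∀ a b c d → a - b + (c - d) ≡ a + c - (b + d)
  lemma = solve-∀

¬Odd-0 : ¬ Odd 0ℤ
¬Odd-0 (+ m , ())
¬Odd-0 (-[1+ m ] , ())

Odd-minus-Even : ∀ x y → Odd x → Even y → Odd (x - y)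
Odd-minus-Even _ _ (v , refl) (w , refl) = v - w , lemma v w
  where
  lemma : ∀ v w → 1ℤ + (v + v) - (w + w) ≡ 1ℤ + ((v - w) + (v - w))
  lemma = solve-∀

V-Odd : ∀ {n} {v : Weight n} → v ∈ V n → Odd (total v)
V-Odd {suc n} (here refl)         = 0ℤ , cong (_+_ 1ℤ) (total-0ʷ n)
V-Odd {suc n} (there (here refl)) = -1ℤ , cong (_+_ -1ℤ) (total-0ʷ n)
V-Odd {suc n} (there (there p)) with u , u∈ , refl ← ∈-map⁻ (0ℤ ∷_) p
  with w , eq ← V-Odd u∈ =
  w , trans (+-identityˡ _) eq

positiveRoots-Even : ∀ n {α} → α ∈ positiveRoots n → Even (total α)
positiveRoots-Even (suc n) {x ∷ α} p with positiveRoots-suc⁻ p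
... | inj₁ (refl , α∈) with w , eq ← V-Odd α∈ = 1ℤ + w , trans (cong (_+_ 1ℤ) eq) (lemma w)
  where
  lemma : ∀ w → 1ℤ + (1ℤ + (w + w)) ≡ 1ℤ + w + (1ℤ + w)
  lemma = solve-∀
... | inj₂ (inj₁ (refl , α∈)) with w , eq ← positiveRoots-Even n α∈ = w , trans (+-identityˡ _) eq
... | inj₂ (inj₂ (refl , refl)) = 1ℤ , cong (_+_ (+ 2)) (total-0ʷ n)

𝒫-Odd : ∀ {n} {γ : Weight n} → Odd (total γ) → 𝒫 γ ≈ 𝟘
𝒫-Odd {n} {γ} odd k = divides-vanish (Odd ∘ total) (positiveRoots n) {one}
  (λ {α} {β} α∈ β-odd → subst Odd (sym (total--ʷ β α)) (Odd-minus-Even (total β) (total α) β-odd (positiveRoots-Even n α∈)))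
  one-Odd k {γ} odd
  where
  one-Odd : ∀ k {β : Weight n} → Odd (total β) → one k β ≡ 0ℤ
  one-Odd k {β} odd rewrite dec-false (β ≟ʷ 0ʷ) (λ { refl → ¬Odd-0 (subst Odd (total-0ʷ n) odd) })
    | ∧-zeroʳ (does (k ℕₚ.≟ 0)) = refl

-- Taking an entry out preserves the coordinate sum, so g only has to vanish where this invariant
-- holds.
laplace-vanish : ∀ {n} (a : Weight (suc n)) {g : ℤ → Weight n → ℤ} →
  (∀ y ys → y + total ys ≡ total a → g y ys ≡ 0ℤ) → laplace a g ≡ 0ℤ
laplace-vanish {zero}  (x ∷ []) g≡0 = g≡0 x [] refl
laplace-vanish {suc n} (x ∷ xs) g≡0 = cong₂ _-_ (g≡0 x xs refl)
  (laplace-vanish xs (λ y ys eq → g≡0 y (x ∷ ys) (trans (lemma y x (total ys)) (cong (_+_ x) eq))))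
  where
  lemma : ∀ y x t → y + (x + t) ≡ x + (y + t)
  lemma = solve-∀

-- Changing the sign of an entry y changes the sum by 2y and keeps its parity, which accounts for
-- the witness `w + y`.
alt-vanish : ∀ {n} (a : Weight n) {F : Weight n → ℤ} →
  (∀ γ → Even (total a - total γ) → F γ ≡ 0ℤ) → alt a F ≡ 0ℤ
alt-vanish {zero}  [] F≡0 = F≡0 [] (0ℤ , refl)
alt-vanish {suc n} a {F} F≡0 = laplace-vanish a λ y ys eq → cong₂ _-_
  (alt-vanish ys λ γ (w , eq′) → F≡0 (y ∷ γ) (w ,
    trans (cong (_- (y + total γ)) (sym eq)) (trans (lemma₊ y (total ys) (total γ)) eq′)))
  (alt-vanish ys λ γ (w , eq′) → F≡0 (- y ∷ γ) (w + y ,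
    trans (cong (_- (- y + total γ)) (sym eq)) (trans (lemma₋ y (total ys) (total γ))
      (trans (cong (_+ (y + y)) eq′) (rearrange w y)))))
  where
  lemma₊ : ∀ y s t → y + s - (y + t) ≡ s - t
  lemma₊ = solve-∀
  lemma₋ : ∀ y s t → y + s - (- y + t) ≡ s - t + (y + y)
  lemma₋ = solve-∀
  rearrange : ∀ w y → w + w + (y + y) ≡ w + y + (w + y)
  rearrange = solve-∀

-- Linearity of alternating sums

laplace-0 : ∀ {n} (a : Weight (suc n)) {g : ℤ → Weight n → ℤ} → (∀ y ys → g y ys ≡ 0ℤ) → laplace a g ≡ 0ℤ
laplace-0 a g≡0 = laplace-vanish a (λ y ys _ → g≡0 y ys)

laplace-+ : ∀ {n} (a : Weight (suc n)) (g h : ℤ → Weight n → ℤ) →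
  laplace a (λ y ys → g y ys + h y ys) ≡ laplace a g + laplace a h
laplace-+ {zero}  (x ∷ []) g h = refl
laplace-+ {suc n} (x ∷ xs) g h = trans
  (cong (λ z → g x xs + h x xs - z) (laplace-+ xs (λ y ys → g y (x ∷ ys)) (λ y ys → h y (x ∷ ys))))
  (lemma (g x xs) (h x xs) _ _)
  where
  lemma : ∀ a b c d → a + b - (c + d) ≡ a - c + (b - d)
  lemma = solve-∀

alt-cong : ∀ {n} (a : Weight n) {F G : Weight n → ℤ} → (∀ γ → F γ ≡ G γ) → alt a F ≡ alt a G
alt-cong {zero}  a F≗G = F≗G []
alt-cong {suc n} a F≗G = laplace-cong a λ y ys →
  cong₂ _-_ (alt-cong ys (λ γ → F≗G (y ∷ γ))) (alt-cong ys (λ γ → F≗G (- y ∷ γ)))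

alt-0 : ∀ {n} (a : Weight n) {F : Weight n → ℤ} → (∀ γ → F γ ≡ 0ℤ) → alt a F ≡ 0ℤ
alt-0 a F≡0 = alt-vanish a (λ γ _ → F≡0 γ)

alt-+ : ∀ {n} (a : Weight n) (F G : Weight n → ℤ) → alt a (λ γ → F γ + G γ) ≡ alt a F + alt a G
alt-+ {zero}  a F G = refl
alt-+ {suc n} a F G = trans
  (laplace-cong a λ y ys → trans
    (cong₂ _-_ (alt-+ ys (F ∘ (y ∷_)) (G ∘ (y ∷_))) (alt-+ ys (F ∘ (- y ∷_)) (G ∘ (- y ∷_))))
    (lemma (alt ys (F ∘ (y ∷_))) _ _ _))
  (laplace-+ a _ _)
  where
  lemma : ∀ a b c d → a + b - (c + d) ≡ a - c + (b - d)
  lemma = solve-∀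

alt-∑ : ∀ {n} {A : Set} (a : Weight n) (xs : List A) (F : A → Weight n → ℤ) →
  alt a (λ γ → ∑ xs (λ x → F x γ)) ≡ ∑ xs (λ x → alt a (F x))
alt-∑ a []       F = alt-0 a (λ γ → refl)
alt-∑ a (x ∷ xs) F = trans (alt-+ a (F x) _) (cong (_+_ (alt a (F x))) (alt-∑ a xs F))

alt-∑≤ : ∀ {n} {A : Set} (a : Weight n) (xs : List A) (F : A → A → Weight n → ℤ) →
  alt a (λ γ → ∑≤ xs (λ x y → F x y γ)) ≡ ∑≤ xs (λ x y → alt a (F x y))
alt-∑≤ a []       F = alt-0 a (λ γ → refl)
alt-∑≤ a (x ∷ xs) F = trans (alt-+ a (λ γ → ∑ (x ∷ xs) (λ y → F x y γ)) _)
  (cong₂ _+_ (alt-∑ a (x ∷ xs) (F x)) (alt-∑≤ a xs F))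

alt-↑ : ∀ {n} (a : Weight n) (F : Weight n → Series) k →
  alt a (λ γ → ↑ (F γ) k) ≡ ↑ (λ i → alt a (λ γ → F γ i)) k
alt-↑ a F zero    = alt-0 a (λ γ → refl)
alt-↑ a F (suc k) = refl

-- 𝒩 (λ + ρ) μ is the Kostka–Foulkes polynomial K_{λ,μ}, for arbitrary weights μ.
𝒩 : ∀ {n} → Weight n → Weight n → Series
𝒩 {n} a v k = alt a (λ γ → 𝒫 (γ -ʷ (ρ n +ʷ v)) k)

-- The contribution to the Laplace expansion of a first coordinate c.
Φ : ∀ {n} → ℤ → Weight n → Weight n → Series
Φ {n} c a v k = alt a (λ γ → 𝒫 (c ∷ γ -ʷ (ρ n +ʷ v)) k)

kostkaFoulkes≈𝒩 : ∀ {n} (lam μ : Weight n) → kostkaFoulkes lam μ ≈ 𝒩 (lam +ʷ ρ n) μ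
kostkaFoulkes≈𝒩 {n} lam μ k = trans
  (∑-W n (lam +ʷ ρ n) (λ γ → 𝒫 (γ -ʷ (μ +ʷ ρ n)) k))
  (cong (λ b → alt (lam +ʷ ρ n) (λ γ → 𝒫 (γ -ʷ b) k)) (+ʷ-comm μ (ρ n)))

kostkaFoulkes-Odd : ∀ {n} (lam μ : Weight n) → Odd (total lam - total μ) → kostkaFoulkes lam μ ≈ 𝟘
kostkaFoulkes-Odd {n} lam μ odd k = trans (∑-W n (lam +ʷ ρ n) (λ γ → 𝒫 (γ -ʷ (μ +ʷ ρ n)) k)) (alt-vanish (lam +ʷ ρ n) λ γ even →
  𝒫-Odd {γ = γ -ʷ (μ +ʷ ρ n)} (subst Odd (sym (trans (total--ʷ γ (μ +ʷ ρ n)) (eq γ))) (Odd-minus-Even (total lam - total μ) _ odd even)) k)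
  where
  lemma : ∀ g m r l → g - (m + r) ≡ l - m - (l + r - g)
  lemma = solve-∀
  eq : ∀ γ → total γ - total (μ +ʷ ρ n) ≡ total lam - total μ - (total (lam +ʷ ρ n) - total γ)
  eq γ rewrite total-+ʷ μ (ρ n) | total-+ʷ lam (ρ n) = lemma (total γ) (total μ) (total (ρ n)) (total lam)

-- Expansion along the first coordinate

module _ {n : ℕ} (a v : Weight n) where

  Φ-neg : ∀ {c} → c < 0ℤ → Φ c a v ≈ 𝟘
  Φ-neg { -[1+ m ]} _ k = alt-0 a (λ γ → 𝒫-neg m (γ -ʷ (ρ n +ʷ v)) k)
  Φ-neg {+ m} (+<+ ())

  Φ-0 : Φ 0ℤ a v ≈ 𝒩 a v
  Φ-0 k = alt-cong a (λ γ → 𝒫-0 (γ -ʷ (ρ n +ʷ v)) k)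

  Φ-1 : Φ 1ℤ a v ≈ ↑ (λ i → ∑ (V n) (λ w → 𝒩 a (v +ʷ w) i))
  Φ-1 k = begin
    alt a (λ γ → 𝒫 (1ℤ ∷ γ -ʷ (ρ n +ʷ v)) k)
      ≡⟨ alt-cong a (λ γ → 𝒫-1 (γ -ʷ (ρ n +ʷ v)) k) ⟩
    alt a (λ γ → ↑ (λ i → ∑ (V n) (λ w → 𝒫 (γ -ʷ (ρ n +ʷ v) -ʷ w) i)) k)
      ≡⟨ alt-↑ a (λ γ i → ∑ (V n) (λ w → 𝒫 (γ -ʷ (ρ n +ʷ v) -ʷ w) i)) k ⟩
    ↑ (λ i → alt a (λ γ → ∑ (V n) (λ w → 𝒫 (γ -ʷ (ρ n +ʷ v) -ʷ w) i))) k
      ≡⟨ ↑-cong (λ i → trans (alt-∑ a (V n) _)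
           (∑-cong (V n) (λ w → alt-cong a (λ γ → cong (λ β → 𝒫 β i) (assoc γ w))))) k ⟩
    ↑ (λ i → ∑ (V n) (λ w → 𝒩 a (v +ʷ w) i)) k ∎
    where
    open ≡-Reasoning
    assoc : ∀ γ w → γ -ʷ (ρ n +ʷ v) -ʷ w ≡ γ -ʷ (ρ n +ʷ (v +ʷ w))
    assoc γ w = trans (-ʷ-+ʷ γ (ρ n +ʷ v) w) (cong (γ -ʷ_) (+ʷ-assoc (ρ n) v w))

  Φ-2 : ∀ k → Φ (+ 2) a v k ≡
    ↑ (𝒩 a v) k + ↑ (↑ (λ i → ∑≤ (V n) (λ w u → 𝒩 a (v +ʷ (w +ʷ u)) i))) k
  Φ-2 k = begin
    alt a (λ γ → 𝒫 (+ 2 ∷ γ -ʷ (ρ n +ʷ v)) k)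
      ≡⟨ alt-cong a (λ γ → 𝒫-2 (γ -ʷ (ρ n +ʷ v)) k) ⟩
    alt a (λ γ → ↑ (𝒫 (γ -ʷ (ρ n +ʷ v))) k + ↑ (↑ (H γ)) k)
      ≡⟨ alt-+ a _ _ ⟩
    alt a (λ γ → ↑ (𝒫 (γ -ʷ (ρ n +ʷ v))) k) + alt a (λ γ → ↑ (↑ (H γ)) k)
      ≡⟨ cong₂ _+_ (alt-↑ a (λ γ → 𝒫 (γ -ʷ (ρ n +ʷ v))) k)
           (trans (alt-↑ a (λ γ → ↑ (H γ)) k) (↑-cong (λ i → trans (alt-↑ a H i) (↑-cong inner i)) k)) ⟩
    _ ∎
    where
    open ≡-Reasoning
    H : Weight n → Series
    H γ i = ∑≤ (V n) (λ w u → 𝒫 (γ -ʷ (ρ n +ʷ v) -ʷ w -ʷ u) i)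
    assoc : ∀ γ w u → γ -ʷ (ρ n +ʷ v) -ʷ w -ʷ u ≡ γ -ʷ (ρ n +ʷ (v +ʷ (w +ʷ u)))
    assoc γ w u = trans (-ʷ-+ʷ (γ -ʷ (ρ n +ʷ v)) w u)
      (trans (-ʷ-+ʷ γ (ρ n +ʷ v) (w +ʷ u)) (cong (γ -ʷ_) (+ʷ-assoc (ρ n) v (w +ʷ u))))
    inner : (λ i → alt a (λ γ → H γ i)) ≈ (λ i → ∑≤ (V n) (λ w u → 𝒩 a (v +ʷ (w +ʷ u)) i))
    inner i = trans (alt-∑≤ a (V n) _)
      (∑≤-cong (V n) (λ w u → alt-cong a (λ γ → cong (λ β → 𝒫 β i) (assoc γ w u))))

-- The term of the Laplace expansion belonging to the entry y, for b the
-- first coordinate of ρ + μ.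
term : ∀ {n} → ℤ → ℤ → Weight n → Weight n → Series
term b y ys v k = Φ (y - b) ys v k - Φ (- y - b) ys v k

-- Holds by computation. The equation for `j` lets the callers supply the first coordinate of ρ + μ
-- in a normal form that can be compared with the entries of a.
𝒩-laplace : ∀ {n} (a : Weight (suc n)) x (v : Weight n) {j} → + suc n + x ≡ j → ∀ k →
  𝒩 a (x ∷ v) k ≡ laplace a (λ y ys → term j y ys v k)
𝒩-laplace a x v refl k = refl

module _ {n : ℕ} (ys v : Weight n) (k : ℕ) where

  term-< : ∀ {i j} → suc i ℕ.< j → term (+ j) (+ suc i) ys v k ≡ 0ℤ
  term-< {i} {suc j} i<j = cong₂ _-_
    (Φ-neg ys v (subst (+ suc i - + suc j <_) (+-inverseʳ (+ suc j)) (+-monoˡ-< (- + suc j) (+<+ i<j))) k)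
    (Φ-neg ys v { -[1+ i ] - + suc j} -<+ k)

  -- The entry taken with a minus sign leads to a negative first coordinate, so only the plus sign
  -- survives, with excess d.
  term-≡ : ∀ {i j} d → suc i ≡ d ℕ.+ j → term (+ j) (+ suc i) ys v k ≡ Φ (+ d) ys v k
  term-≡ {i} {j} d eq = begin
    Φ (+ suc i - + j) ys v k - Φ (-[1+ i ] - + j) ys v k
      ≡⟨ cong₂ (λ c z → Φ c ys v k - z) difference (Φ-neg ys v (negative j) k) ⟩
    Φ (+ d) ys v k - 0ℤ
      ≡⟨ +-identityʳ _ ⟩
    Φ (+ d) ys v k ∎
    where
    open ≡-Reasoning
    lemma : ∀ d j → d + j - j ≡ d
    lemma = solve-∀
    difference : + suc i - + j ≡ + d
    difference = trans (cong (λ m → + m - + j) eq) (lemma (+ d) (+ j))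
    negative : ∀ j → -[1+ i ] - + j < 0ℤ
    negative zero    = -<+
    negative (suc j) = -<+

Below : ∀ {n} → ℕ → Weight n → Set
Below j = All (λ y → ∃ λ i → y ≡ + suc i × suc i ℕ.< j)

ρ-Below : ∀ m {j} → m ℕ.< j → Below j (ρ m)
ρ-Below zero    _   = []
ρ-Below (suc m) m<j = (m , refl , m<j) ∷ ρ-Below m (ℕₚ.<-trans ℕₚ.≤-refl m<j)

-- The remainder passed to g also contains the entries already skipped, hence a hypothesis for every
-- remainder.
laplace-All-0 : ∀ {n} (a : Weight (suc n)) {g : ℤ → Weight n → ℤ} → All (λ y → ∀ ys → g y ys ≡ 0ℤ) a →
  laplace a g ≡ 0ℤ
laplace-All-0 {zero}  (x ∷ []) (g≡0 ∷ [])  = g≡0 []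
laplace-All-0 {suc n} (x ∷ xs) (g≡0 ∷ all) =
  cong₂ _-_ (g≡0 xs) (laplace-All-0 xs (All.map (λ p ys → p (x ∷ ys)) all))

laplace-head : ∀ {n} x (xs : Weight n) {g : ℤ → Weight n → ℤ} → All (λ y → ∀ ys → g y ys ≡ 0ℤ) xs →
  laplace (x ∷ xs) g ≡ g x xs
laplace-head {zero}  x []          all = refl
laplace-head {suc n} x xs {g} all = trans
  (cong (λ z → g x xs - z) (laplace-All-0 xs (All.map (λ p ys → p (x ∷ ys)) all))) (+-identityʳ _)

Below⇒term-0 : ∀ {n m j} {xs : Weight m} → Below j xs → (v : Weight n) (k : ℕ) →
  All (λ y → ∀ ys → term (+ j) y ys v k ≡ 0ℤ) xs
Below⇒term-0 below v k = All.map (λ { (i , refl , i<j) ys → term-< ys v k i<j }) below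

𝒩-Below : ∀ {n} (a : Weight (suc n)) x v {j} → + suc n + x ≡ + j → Below j a → 𝒩 a (x ∷ v) ≈ 𝟘
𝒩-Below a x v b≡ below k = trans (𝒩-laplace a x v b≡ k) (laplace-All-0 a (Below⇒term-0 below v k))

-- If only the first entry of a reaches b, the expansion has a single term.
𝒩-head : ∀ {n} {i} (xs : Weight n) x v {j} d → + suc n + x ≡ + j → suc i ≡ d ℕ.+ j → Below j xs →
  𝒩 (+ suc i ∷ xs) (x ∷ v) ≈ Φ (+ d) xs v
𝒩-head {i = i} xs x v d b≡ i≡ below k = trans (𝒩-laplace (+ suc i ∷ xs) x v b≡ k)
  (trans (laplace-head (+ suc i) xs (Below⇒term-0 below v k)) (term-≡ xs v k d i≡))

-- Choosing one of the two entries that reach b leaves the other in the vector, so each term has its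
-- own weight λ + ρ of the lower rank.
𝒩-head₂ : ∀ {n} {i i′} (xs : Weight n) x v {j} d e → + suc (suc n) + x ≡ + j →
  suc i ≡ d ℕ.+ j → suc i′ ≡ e ℕ.+ j → Below j xs → ∀ k →
  𝒩 (+ suc i ∷ + suc i′ ∷ xs) (x ∷ v) k ≡ Φ (+ d) (+ suc i′ ∷ xs) v k - Φ (+ e) (+ suc i ∷ xs) v k
𝒩-head₂ {i = i} {i′} xs x v d e b≡ i≡ i′≡ below k = trans (𝒩-laplace (+ suc i ∷ + suc i′ ∷ xs) x v b≡ k)
  (cong₂ _-_ (term-≡ (+ suc i′ ∷ xs) v k d i≡)
    (trans (laplace-head (+ suc i′) xs (All.map (λ p ys → p (+ suc i ∷ ys)) (Below⇒term-0 below v k)))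
           (term-≡ (+ suc i ∷ xs) v k e i′≡)))

𝒩-head₃ : ∀ {n} {i i′ i″} (xs : Weight n) x v {j} d e f → + suc (suc (suc n)) + x ≡ + j →
  suc i ≡ d ℕ.+ j → suc i′ ≡ e ℕ.+ j → suc i″ ≡ f ℕ.+ j → Below j xs → ∀ k →
  𝒩 (+ suc i ∷ + suc i′ ∷ + suc i″ ∷ xs) (x ∷ v) k ≡
    Φ (+ d) (+ suc i′ ∷ + suc i″ ∷ xs) v k -
    (Φ (+ e) (+ suc i ∷ + suc i″ ∷ xs) v k - Φ (+ f) (+ suc i ∷ + suc i′ ∷ xs) v k)
𝒩-head₃ {i = i} {i′} {i″} xs x v d e f b≡ i≡ i′≡ i″≡ below k =
  trans (𝒩-laplace (+ suc i ∷ + suc i′ ∷ + suc i″ ∷ xs) x v b≡ k)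
  (cong₂ _-_ (term-≡ (+ suc i′ ∷ + suc i″ ∷ xs) v k d i≡)
  (cong₂ _-_ (term-≡ (+ suc i ∷ + suc i″ ∷ xs) v k e i′≡)
    (trans (laplace-head (+ suc i″) xs (All.map (λ p ys → p (+ suc i ∷ + suc i′ ∷ ys)) (Below⇒term-0 below v k)))
           (term-≡ (+ suc i ∷ + suc i′ ∷ xs) v k f i″≡))))

-- Weights above ρ

𝒩-ρ-0 : ∀ m v → 𝒩 (ρ (suc m)) (0ℤ ∷ v) ≈ 𝒩 (ρ m) v
𝒩-ρ-0 m v k = trans
  (𝒩-head (ρ m) 0ℤ v 0 (+-identityʳ _) refl (ρ-Below m (ℕₚ.n<1+n m)) k)
  (Φ-0 (ρ m) v k)

𝒩-ρ-pos : ∀ m p v → 𝒩 (ρ (suc m)) (+ suc p ∷ v) ≈ 𝟘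
𝒩-ρ-pos m p v = 𝒩-Below (ρ (suc m)) (+ suc p) v refl (ρ-Below (suc m) (ℕₚ.m<m+n (suc m) ℕ.z<s))

𝒩-ρ-0ʷ : ∀ m → 𝒩 (ρ m) 0ʷ ≈ 𝟙
𝒩-ρ-0ʷ zero    zero    = refl
𝒩-ρ-0ʷ zero    (suc k) = refl
𝒩-ρ-0ʷ (suc m) k       = trans (𝒩-ρ-0 m 0ʷ k) (𝒩-ρ-0ʷ m k)

-- K_{(1),v} and K_{(2),∅}, set to zero in rank 0.
K₁ : ∀ m → Weight m → Series
K₁ zero    v = 𝟘
K₁ (suc m) v = 𝒩 (+ suc (suc m) ∷ ρ m) v

K₂ : ℕ → Series
K₂ zero    = 𝟘
K₂ (suc m) = 𝒩 (+ suc (suc (suc m)) ∷ ρ m) 0ʷ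

-- Now b = m, which the entries m + 1 and m of ρ reach with excess 1 and 0. Deleting the second
-- leaves (1) + ρ in rank m. For m = 0 that entry is missing, in agreement with `K₁ zero v = 𝟘`.
𝒩-ρ-neg : ∀ m v k → 𝒩 (ρ (suc m)) (-1ℤ ∷ v) k ≡
  ↑ (λ i → ∑ (V m) (λ w → 𝒩 (ρ m) (v +ʷ w) i)) k - K₁ m v k
𝒩-ρ-neg zero    v k = trans (𝒩-head [] -1ℤ v {0} 1 refl refl [] k) (trans (Φ-1 [] v k) (sym (+-identityʳ _)))
𝒩-ρ-neg (suc m) v k = trans
  (𝒩-head₂ (ρ m) -1ℤ v 1 0 refl refl refl (ρ-Below m (ℕₚ.n<1+n m)) k)
  (cong₂ _-_ (Φ-1 (ρ (suc m)) v k) (Φ-0 (+ suc (suc m) ∷ ρ m) v k))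

K₁-1 : ∀ m v → K₁ (suc m) (1ℤ ∷ v) ≈ 𝒩 (ρ m) v
K₁-1 m v k = trans
  (𝒩-head (ρ m) 1ℤ v 0 (cong +_ (ℕₚ.+-comm (suc m) 1)) refl (ρ-Below m (ℕₚ.m<n+m m {2} ℕ.z<s)) k)
  (Φ-0 (ρ m) v k)

K₁-0 : ∀ m v → K₁ (suc m) (0ℤ ∷ v) ≈ ↑ (λ i → ∑ (V m) (λ w → 𝒩 (ρ m) (v +ʷ w) i))
K₁-0 m v k = trans
  (𝒩-head (ρ m) 0ℤ v 1 (+-identityʳ _) refl (ρ-Below m (ℕₚ.n<1+n m)) k)
  (Φ-1 (ρ m) v k)

K₂-Φ : ∀ m → K₂ (suc m) ≈ Φ (+ 2) (ρ m) 0ʷ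
K₂-Φ m = 𝒩-head (ρ m) 0ℤ 0ʷ 2 (+-identityʳ _) refl (ρ-Below m (ℕₚ.n<1+n m))

-- The vector begins with m + 2 and m, and b = m, so the excesses are 2 and 0. Deleting the second
-- entry leaves (2) + ρ in rank m; for m = 0 it is missing, in agreement with `K₂ zero = 𝟘`.
K₁-neg : ∀ m k → K₁ (suc m) (-1ℤ ∷ 0ʷ) k ≡ K₂ (suc m) k - K₂ m k
K₁-neg zero    k = trans (𝒩-head [] -1ℤ [] {0} 2 refl refl [] k) (trans (sym (K₂-Φ 0 k)) (sym (+-identityʳ _)))
K₁-neg (suc m) k = trans
  (𝒩-head₂ (ρ m) -1ℤ 0ʷ 2 0 refl refl refl (ρ-Below m (ℕₚ.n<1+n m)) k)
  (cong₂ _-_ (sym (K₂-Φ (suc m) k)) (Φ-0 (+ suc (suc (suc m)) ∷ ρ m) 0ʷ k))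

-- Closed forms

-- q + q³ + ⋯ + q^(2m−1) and 1 + q + ⋯ + q^(2m−1)
oddPowers powers : ℕ → Series
oddPowers zero    k = 0ℤ
oddPowers (suc m) k = oddPowers m k + q^ (suc (m ℕ.+ m)) k
powers    zero    k = 0ℤ
powers    (suc m) k = powers m k + (q^ (m ℕ.+ m) k + q^ (suc (m ℕ.+ m)) k)

↑-+ : ∀ (f g : Series) k → ↑ (λ i → f i + g i) k ≡ ↑ f k + ↑ g k
↑-+ f g zero    = refl
↑-+ f g (suc k) = refl

↑-q^ : ∀ m → ↑ (q^ m) ≈ q^ (suc m)
↑-q^ m zero    = refl
↑-q^ m (suc k) = refl

suc-+-suc : ∀ m → suc m ℕ.+ suc m ≡ suc (suc (m ℕ.+ m))
suc-+-suc m = cong suc (ℕₚ.+-suc m m)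

-- Multiplication by q moves the range of exponents by one: 1 drops out and q^(2m) comes in.
↑-powers : ∀ m k → ↑ (powers m) k ≡ powers m k - 𝟙 k + q^ (m ℕ.+ m) k
↑-powers zero    zero    = refl
↑-powers zero    (suc k) = refl
↑-powers (suc m) k = begin
  ↑ (powers (suc m)) k
    ≡⟨ trans (↑-+ (powers m) _ k) (cong (_+_ (↑ (powers m) k)) (trans (↑-+ (q^ (m ℕ.+ m)) _ k)
         (cong₂ _+_ (↑-q^ (m ℕ.+ m) k) (↑-q^ (suc (m ℕ.+ m)) k)))) ⟩
  ↑ (powers m) k + (q^ (suc (m ℕ.+ m)) k + q^ (suc (suc (m ℕ.+ m))) k)
    ≡⟨ cong (_+ (q^ (suc (m ℕ.+ m)) k + q^ (suc (suc (m ℕ.+ m))) k)) (↑-powers m k) ⟩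
  powers m k - 𝟙 k + q^ (m ℕ.+ m) k + (q^ (suc (m ℕ.+ m)) k + q^ (suc (suc (m ℕ.+ m))) k)
    ≡⟨ lemma (powers m k) (𝟙 k) (q^ (m ℕ.+ m) k) (q^ (suc (m ℕ.+ m)) k) (q^ (suc (suc (m ℕ.+ m))) k) ⟩
  powers (suc m) k - 𝟙 k + q^ (suc (suc (m ℕ.+ m))) k
    ≡⟨ cong (λ j → powers (suc m) k - 𝟙 k + q^ j k) (suc-+-suc m) ⟨
  powers (suc m) k - 𝟙 k + q^ (suc m ℕ.+ suc m) k ∎
  where
  open ≡-Reasoning
  lemma : ∀ p a x y z → p - a + x + (y + z) ≡ p + (x + y) - a + z
  lemma = solve-∀

↑²-oddPowers : ∀ m k → ↑ (↑ (oddPowers m)) k ≡ oddPowers (suc m) k - q^ 1 k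
↑²-oddPowers zero    zero          = refl
↑²-oddPowers zero    (suc zero)    = refl
↑²-oddPowers zero    (suc (suc k)) = refl
↑²-oddPowers (suc m) k = begin
  ↑ (↑ (oddPowers (suc m))) k
    ≡⟨ trans (↑-cong (↑-+ (oddPowers m) (q^ (suc (m ℕ.+ m)))) k) (↑-+ (↑ (oddPowers m)) _ k) ⟩
  ↑ (↑ (oddPowers m)) k + ↑ (↑ (q^ (suc (m ℕ.+ m)))) k
    ≡⟨ cong₂ _+_ (↑²-oddPowers m k) (trans (↑-cong (↑-q^ (suc (m ℕ.+ m))) k) (↑-q^ (suc (suc (m ℕ.+ m))) k)) ⟩
  oddPowers (suc m) k - q^ 1 k + q^ (suc (suc (suc (m ℕ.+ m)))) k
    ≡⟨ lemma (oddPowers (suc m) k) (q^ 1 k) (q^ (suc (suc (suc (m ℕ.+ m)))) k) ⟩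
  oddPowers (suc m) k + q^ (suc (suc (suc (m ℕ.+ m)))) k - q^ 1 k
    ≡⟨ cong (λ j → oddPowers (suc m) k + q^ (suc j) k - q^ 1 k) (suc-+-suc m) ⟨
  oddPowers (suc (suc m)) k - q^ 1 k ∎
  where
  open ≡-Reasoning
  lemma : ∀ a b c → a - b + c ≡ a + c - b
  lemma = solve-∀

-- The exponents 1, ..., 2m are separated into odd and even ones; the even powers are q times the
-- odd ones.
↑-powers-split : ∀ m k → ↑ (powers m) k ≡ oddPowers m k + ↑ (oddPowers m) k
↑-powers-split zero    zero    = refl
↑-powers-split zero    (suc k) = refl
↑-powers-split (suc m) k = begin
  ↑ (powers (suc m)) k
    ≡⟨ trans (↑-+ (powers m) _ k) (cong₂ _+_ (↑-powers-split m k)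
         (trans (↑-+ (q^ (m ℕ.+ m)) _ k) (cong (_+ ↑ o k) (↑-q^ (m ℕ.+ m) k)))) ⟩
  oddPowers m k + ↑ (oddPowers m) k + (o k + ↑ o k)
    ≡⟨ lemma (oddPowers m k) (↑ (oddPowers m) k) (o k) (↑ o k) ⟩
  oddPowers m k + o k + (↑ (oddPowers m) k + ↑ o k)
    ≡⟨ cong (_+_ (oddPowers (suc m) k)) (↑-+ (oddPowers m) o k) ⟨
  oddPowers (suc m) k + ↑ (oddPowers (suc m)) k ∎
  where
  open ≡-Reasoning
  o = q^ (suc (m ℕ.+ m))
  lemma : ∀ a b c d → a + b + (c + d) ≡ a + c + (b + d)
  lemma = solve-∀

-- Sums over the weights of the vector representation

∑-↑ : ∀ {A : Set} (xs : List A) (f : A → Series) k → ∑ xs (λ x → ↑ (f x) k) ≡ ↑ (λ i → ∑ xs (λ x → f x i)) k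
∑-↑ xs f zero    = ∑-zero xs (λ x → refl)
∑-↑ xs f (suc k) = refl

∑-- : ∀ {A : Set} (xs : List A) (f g : A → ℤ) → ∑ xs (λ x → f x - g x) ≡ ∑ xs f - ∑ xs g
∑-- []       f g = refl
∑-- (x ∷ xs) f g = trans (cong (_+_ (f x - g x)) (∑-- xs f g)) (lemma (f x) (g x) _ _)
  where
  lemma : ∀ a b c d → a - b + (c - d) ≡ a + c - (b + d)
  lemma = solve-∀

∑-V-suc : ∀ m (f : Weight (suc m) → ℤ) →
  ∑ (V (suc m)) f ≡ f (1ℤ ∷ 0ʷ) + (f (-1ℤ ∷ 0ʷ) + ∑ (V m) (f ∘ (0ℤ ∷_)))
∑-V-suc m f = cong (λ z → f (1ℤ ∷ 0ʷ) + (f (-1ℤ ∷ 0ʷ) + z)) (∑-map (V m) (0ℤ ∷_) f)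

-- `V (suc m)` begins with e and e′ in this order, so (e , e′) occurs but (e′ , e) does not.
∑≤-V-suc : ∀ m (f : Weight (suc m) → Weight (suc m) → ℤ) →
  let e = 1ℤ ∷ 0ʷ ; e′ = -1ℤ ∷ 0ʷ in
  ∑≤ (V (suc m)) f ≡
    f e e + (f e e′ + ∑ (V m) (λ w → f e (0ℤ ∷ w))) +
    (f e′ e′ + ∑ (V m) (λ w → f e′ (0ℤ ∷ w)) + ∑≤ (V m) (λ v w → f (0ℤ ∷ v) (0ℤ ∷ w)))
∑≤-V-suc m f = cong₂ _+_ (∑-V-suc m (f (1ℤ ∷ 0ʷ)))
  (cong₂ (λ x y → f (-1ℤ ∷ 0ʷ) (-1ℤ ∷ 0ʷ) + x + y) (∑-map (V m) (0ℤ ∷_) _) (∑≤-map (V m) (0ℤ ∷_) f))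

∑K₁ ∑²𝒩 ∑≤𝒩 : ℕ → Series
∑K₁ m k = ∑ (V m) (λ v → K₁ m v k)
∑²𝒩 m k = ∑ (V m) (λ v → ∑ (V m) (λ w → 𝒩 (ρ m) (v +ʷ w) k))
∑≤𝒩 m k = ∑≤ (V m) (λ v w → 𝒩 (ρ m) (v +ʷ w) k)

∑-𝒩-ρ-neg : ∀ m k → ∑ (V m) (λ v → 𝒩 (ρ (suc m)) (-1ℤ ∷ v) k) ≡ ↑ (∑²𝒩 m) k - ∑K₁ m k
∑-𝒩-ρ-neg m k = trans (∑-cong (V m) (λ v → 𝒩-ρ-neg m v k))
  (trans (∑-- (V m) (λ v → ↑ (λ i → ∑ (V m) (λ w → 𝒩 (ρ m) (v +ʷ w) i)) k) (λ v → K₁ m v k))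
         (cong (_- ∑K₁ m k) (∑-↑ (V m) (λ v i → ∑ (V m) (λ w → 𝒩 (ρ m) (v +ʷ w) i)) k)))

Φ-1-K₁ : ∀ m k → Φ 1ℤ (+ suc (suc m) ∷ ρ m) 0ʷ k ≡ ↑ (∑K₁ (suc m)) k
Φ-1-K₁ m k = trans (Φ-1 (+ suc (suc m) ∷ ρ m) 0ʷ k)
  (↑-cong (λ i → ∑-cong (V (suc m)) (λ w → cong (λ v → 𝒩 (+ suc (suc m) ∷ ρ m) v i) (+ʷ-identityˡ w))) k)

Φ-2-ρ : ∀ m k → Φ (+ 2) (ρ m) 0ʷ k ≡ q^ 1 k + ↑ (↑ (∑≤𝒩 m)) k
Φ-2-ρ m k = trans (Φ-2 (ρ m) 0ʷ k) (cong₂ _+_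
  (trans (↑-cong (𝒩-ρ-0ʷ m) k) (↑-q^ 0 k))
  (↑-cong (↑-cong (λ i → ∑≤-cong (V m) (λ w u → cong (λ v → 𝒩 (ρ m) v i) (+ʷ-identityˡ (w +ʷ u))))) k))

∑K₁-suc : ∀ m k → ∑K₁ (suc m) k ≡ 𝟙 k + (K₂ (suc m) k - K₂ m k + ↑ (∑²𝒩 m) k)
∑K₁-suc m k = trans (∑-V-suc m (λ v → K₁ (suc m) v k))
  (cong₂ _+_ (trans (K₁-1 m 0ʷ k) (𝒩-ρ-0ʷ m k))
  (cong₂ _+_ (K₁-neg m k)
    (trans (∑-cong (V m) (λ v → K₁-0 m v k)) (∑-↑ (V m) (λ v i → ∑ (V m) (λ w → 𝒩 (ρ m) (v +ʷ w) i)) k))))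

-- K_{(1,1),∅} in rank m + 2
𝒩-11 : ∀ m k → 𝒩 (+ suc (suc (suc m)) ∷ + suc (suc m) ∷ ρ m) 0ʷ k ≡ ↑ (∑K₁ (suc m)) k - K₂ (suc m) k
𝒩-11 m k = trans
  (𝒩-head₂ (ρ m) 0ℤ 0ʷ 1 0 (+-identityʳ _) refl refl (ρ-Below m (ℕₚ.m<n+m m {2} ℕ.z<s)) k)
  (cong₂ _-_ (Φ-1-K₁ m k) (Φ-0 (+ suc (suc (suc m)) ∷ ρ m) 0ʷ k))

module _ (m : ℕ) where
  private
    f : ℕ → Weight (suc m) → Weight (suc m) → ℤ
    f k v w = 𝒩 (ρ (suc m)) (v +ʷ w) k
    e e′ : Weight (suc m)
    e  = 1ℤ ∷ 0ʷ
    e′ = -1ℤ ∷ 0ʷ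

    constant : ∀ x k → 𝒩 (ρ (suc m)) (x ∷ (0ʷ +ʷ 0ʷ)) k ≡ 𝒩 (ρ (suc m)) (x ∷ 0ʷ) k
    constant x k = cong (λ v → 𝒩 (ρ (suc m)) (x ∷ v) k) (+ʷ-identityˡ 0ʷ)

    unit : ∀ k → 𝒩 (ρ (suc m)) (0ℤ ∷ (0ʷ +ʷ 0ʷ)) k ≡ 𝟙 k
    unit k = trans (constant 0ℤ k) (𝒩-ρ-0ʷ (suc m) k)

    -- The sum e + e′ is the zero weight and contributes 1; all other sums with e keep a positive
    -- first coordinate and contribute 0.
    f-e : ∀ k → f k e e + (f k e e′ + ∑ (V m) (λ w → f k e (0ℤ ∷ w))) ≡ 0ℤ + (𝟙 k + 0ℤ)
    f-e k = cong₂ _+_ (𝒩-ρ-pos m 1 (0ʷ +ʷ 0ʷ) k)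
      (cong₂ _+_ (unit k) (∑-zero (V m) (λ w → 𝒩-ρ-pos m 0 (0ʷ +ʷ w) k)))

    ∑-f-e′ : ∀ k → ∑ (V m) (λ w → f k e′ (0ℤ ∷ w)) ≡ ↑ (∑²𝒩 m) k - ∑K₁ m k
    ∑-f-e′ k = trans (∑-cong (V m) (λ w → cong (λ v → 𝒩 (ρ (suc m)) (-1ℤ ∷ v) k) (+ʷ-identityˡ w))) (∑-𝒩-ρ-neg m k)

    f-0 : ∀ k v → ∑ (V (suc m)) (f k (0ℤ ∷ v)) ≡
      𝒩 (ρ (suc m)) (-1ℤ ∷ v) k + ∑ (V m) (λ w → 𝒩 (ρ m) (v +ʷ w) k)
    f-0 k v = trans (∑-V-suc m (f k (0ℤ ∷ v))) (trans (cong₂ _+_ (𝒩-ρ-pos m 0 (v +ʷ 0ʷ) k)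
      (cong₂ _+_ (cong (λ v → 𝒩 (ρ (suc m)) (-1ℤ ∷ v) k) (+ʷ-identityʳ v))
        (∑-cong (V m) (λ w → 𝒩-ρ-0 m (v +ʷ w) k)))) (+-identityˡ _))

  ∑≤𝒩-suc : ∀ k → ∑≤𝒩 (suc m) k ≡
    0ℤ + (𝟙 k + 0ℤ) + (𝒩 (ρ (suc m)) (-[1+ 1 ] ∷ 0ʷ) k + (↑ (∑²𝒩 m) k - ∑K₁ m k) + ∑≤𝒩 m k)
  ∑≤𝒩-suc k = trans (∑≤-V-suc m (f k)) (cong₂ _+_ (f-e k)
    (cong₂ _+_ (cong₂ _+_ (constant -[1+ 1 ] k) (∑-f-e′ k))
      (∑≤-cong (V m) (λ v w → 𝒩-ρ-0 m (v +ʷ w) k))))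

  -- For ordered pairs, in contrast to `∑≤𝒩-suc`, (e′ , e) gives a second 1, and the pairs of e′
  -- with a weight of rank m count in both orders.
  ∑²𝒩-suc : ∀ k → ∑²𝒩 (suc m) k ≡ 0ℤ + (𝟙 k + 0ℤ) +
    (𝟙 k + (𝒩 (ρ (suc m)) (-[1+ 1 ] ∷ 0ʷ) k + (↑ (∑²𝒩 m) k - ∑K₁ m k)) + (↑ (∑²𝒩 m) k - ∑K₁ m k + ∑²𝒩 m k))
  ∑²𝒩-suc k = trans (∑-V-suc m (λ v → ∑ (V (suc m)) (f k v)))
    (cong₂ _+_ (trans (∑-V-suc m (f k e)) (f-e k))
    (cong₂ _+_ (trans (∑-V-suc m (f k e′)) (cong₂ _+_ (unit k) (cong₂ _+_ (constant -[1+ 1 ] k) (∑-f-e′ k))))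
      (trans (∑-cong (V m) (f-0 k)) (trans (∑-+ (V m) _ _) (cong (_+ ∑²𝒩 m k) (∑-𝒩-ρ-neg m k))))))

-- Simultaneous induction on the rank. The first four statements at rank m + 1 rest on those at rank
-- m, on `𝒩-ρ--2 m` and on `Φ-2-ρ≈oddPowers m` (`∑K₁` by way of `K₂` at the same rank); the latter
-- two rest on the first four at ranks at most m.
K₂≈oddPowers : ∀ m → K₂ m ≈ oddPowers m
∑≤𝒩≈oddPowers : ∀ m → ∑≤𝒩 m ≈ oddPowers m
∑K₁≈powers : ∀ m → ∑K₁ m ≈ powers m
∑²𝒩≈powers : ∀ m → ∑²𝒩 m ≈ powers m
-- The case λ = ∅, μ = -2ε₀ in rank m + 1. Here b = m - 1, so the entries m + 1, m and m - 1 of ρ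
-- all reach it; ranks one and two have fewer entries and are treated separately.
𝒩-ρ--2 : ∀ m k → 𝒩 (ρ (suc m)) (-[1+ 1 ] ∷ 0ʷ) k ≡ q^ (suc (m ℕ.+ m)) k - q^ (m ℕ.+ m) k
Φ-2-ρ≈oddPowers : ∀ m → Φ (+ 2) (ρ m) 0ʷ ≈ oddPowers (suc m)

Φ-2-ρ≈oddPowers m k = begin
  Φ (+ 2) (ρ m) 0ʷ k                                ≡⟨ Φ-2-ρ m k ⟩
  q^ 1 k + ↑ (↑ (∑≤𝒩 m)) k                          ≡⟨ cong (_+_ (q^ 1 k)) (↑-cong (↑-cong (∑≤𝒩≈oddPowers m)) k) ⟩
  q^ 1 k + ↑ (↑ (oddPowers m)) k                    ≡⟨ cong (_+_ (q^ 1 k)) (↑²-oddPowers m k) ⟩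
  q^ 1 k + (oddPowers (suc m) k - q^ 1 k)           ≡⟨ lemma (q^ 1 k) (oddPowers (suc m) k) ⟩
  oddPowers (suc m) k                               ∎
  where
  open ≡-Reasoning
  lemma : ∀ a b → a + (b - a) ≡ b
  lemma = solve-∀

K₂≈oddPowers zero    k = refl
K₂≈oddPowers (suc m) k = trans (K₂-Φ m k) (Φ-2-ρ≈oddPowers m k)

∑K₁≈powers zero    k = refl
∑K₁≈powers (suc m) k = begin
  ∑K₁ (suc m) k
    ≡⟨ ∑K₁-suc m k ⟩
  𝟙 k + (K₂ (suc m) k - K₂ m k + ↑ (∑²𝒩 m) k)
    ≡⟨ cong (_+_ (𝟙 k)) (cong₂ _+_ (cong₂ _-_ (K₂≈oddPowers (suc m) k) (K₂≈oddPowers m k))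
         (trans (↑-cong (∑²𝒩≈powers m) k) (↑-powers m k))) ⟩
  𝟙 k + (oddPowers m k + q^ (suc (m ℕ.+ m)) k - oddPowers m k + (powers m k - 𝟙 k + q^ (m ℕ.+ m) k))
    ≡⟨ lemma (𝟙 k) (oddPowers m k) (q^ (suc (m ℕ.+ m)) k) (powers m k) (q^ (m ℕ.+ m) k) ⟩
  powers (suc m) k ∎
  where
  open ≡-Reasoning
  lemma : ∀ a o x p y → a + (o + x - o + (p - a + y)) ≡ p + (y + x)
  lemma = solve-∀

∑≤𝒩≈oddPowers zero    k = refl
∑≤𝒩≈oddPowers (suc m) k = begin
  ∑≤𝒩 (suc m) k
    ≡⟨ ∑≤𝒩-suc m k ⟩
  0ℤ + (𝟙 k + 0ℤ) + (𝒩 (ρ (suc m)) (-[1+ 1 ] ∷ 0ʷ) k + (↑ (∑²𝒩 m) k - ∑K₁ m k) + ∑≤𝒩 m k)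
    ≡⟨ cong (_+_ (0ℤ + (𝟙 k + 0ℤ))) (cong₂ _+_ (cong₂ _+_ (𝒩-ρ--2 m k)
         (cong₂ _-_ (trans (↑-cong (∑²𝒩≈powers m) k) (↑-powers m k)) (∑K₁≈powers m k))) (∑≤𝒩≈oddPowers m k)) ⟩
  0ℤ + (𝟙 k + 0ℤ) + (q^ (suc (m ℕ.+ m)) k - q^ (m ℕ.+ m) k + (powers m k - 𝟙 k + q^ (m ℕ.+ m) k - powers m k) + oddPowers m k)
    ≡⟨ lemma (𝟙 k) (q^ (suc (m ℕ.+ m)) k) (q^ (m ℕ.+ m) k) (powers m k) (oddPowers m k) ⟩
  oddPowers (suc m) k ∎
  where
  open ≡-Reasoning
  lemma : ∀ a x y p o → 0ℤ + (a + 0ℤ) + (x - y + (p - a + y - p) + o) ≡ o + x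
  lemma = solve-∀

∑²𝒩≈powers zero    k = refl
∑²𝒩≈powers (suc m) k = begin
  ∑²𝒩 (suc m) k
    ≡⟨ ∑²𝒩-suc m k ⟩
  0ℤ + (𝟙 k + 0ℤ) + (𝟙 k + (𝒩 (ρ (suc m)) (-[1+ 1 ] ∷ 0ʷ) k + (↑ (∑²𝒩 m) k - ∑K₁ m k)) + (↑ (∑²𝒩 m) k - ∑K₁ m k + ∑²𝒩 m k))
    ≡⟨ cong₂ (λ t p → 0ℤ + (𝟙 k + 0ℤ) + (𝟙 k + (𝒩 (ρ (suc m)) (-[1+ 1 ] ∷ 0ʷ) k + t) + (t + p)))
         (cong₂ _-_ (trans (↑-cong (∑²𝒩≈powers m) k) (↑-powers m k)) (∑K₁≈powers m k)) (∑²𝒩≈powers m k) ⟩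
  0ℤ + (𝟙 k + 0ℤ) + (𝟙 k + (𝒩 (ρ (suc m)) (-[1+ 1 ] ∷ 0ʷ) k + t) + (t + powers m k))
    ≡⟨ cong (λ x → 0ℤ + (𝟙 k + 0ℤ) + (𝟙 k + (x + t) + (t + powers m k))) (𝒩-ρ--2 m k) ⟩
  0ℤ + (𝟙 k + 0ℤ) + (𝟙 k + (q^ (suc (m ℕ.+ m)) k - q^ (m ℕ.+ m) k + t) + (t + powers m k))
    ≡⟨ lemma (𝟙 k) (q^ (suc (m ℕ.+ m)) k) (q^ (m ℕ.+ m) k) (powers m k) ⟩
  powers (suc m) k ∎
  where
  open ≡-Reasoning
  t = powers m k - 𝟙 k + q^ (m ℕ.+ m) k - powers m k
  lemma : ∀ a x y p → let t = p - a + y - p in 0ℤ + (a + 0ℤ) + (a + (x - y + t) + (t + p)) ≡ p + (y + x)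
  lemma = solve-∀

-- In rank one b = -1, and the negative of the single entry survives too: the first coordinates are
-- 1 + 1 and -1 + 1.
𝒩-ρ--2 zero k = cong₂ _-_ (trans (Φ-2-ρ≈oddPowers 0 k) (+-identityˡ (q^ 1 k))) (trans (Φ-0 [] [] k) (𝒩-ρ-0ʷ 0 k))
𝒩-ρ--2 (suc zero) k = begin
  𝒩 (ρ 2) (-[1+ 1 ] ∷ 0ʷ) k
    ≡⟨ 𝒩-head₂ [] -[1+ 1 ] 0ʷ {0} 2 1 refl refl refl [] k ⟩
  Φ (+ 2) (ρ 1) 0ʷ k - Φ 1ℤ (+ 2 ∷ []) 0ʷ k
    ≡⟨ cong₂ _-_ (Φ-2-ρ≈oddPowers 1 k) (trans (Φ-1-K₁ 0 k) (trans (↑-cong (∑K₁≈powers 1) k) (↑-powers 1 k))) ⟩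
  0ℤ + q^ 1 k + q^ 3 k - (0ℤ + (q^ 0 k + q^ 1 k) - 𝟙 k + q^ 2 k)
    ≡⟨ lemma (q^ 0 k) (q^ 1 k) (q^ 2 k) (q^ 3 k) ⟩
  q^ 3 k - q^ 2 k ∎
  where
  open ≡-Reasoning
  lemma : ∀ a b c d → 0ℤ + b + d - (0ℤ + (a + b) - a + c) ≡ d - c
  lemma = solve-∀
𝒩-ρ--2 (suc (suc m)) k = begin
  𝒩 (ρ (suc l⁺)) (-[1+ 1 ] ∷ 0ʷ) k
    -- Deleting each of the three entries leaves λ + ρ for λ = ∅, (1), (1,1) respectively, with
    -- excess 2, 1, 0 and alternating signs.
    ≡⟨ 𝒩-head₃ (ρ m) -[1+ 1 ] 0ʷ 2 1 0 refl refl refl refl (ρ-Below m (ℕₚ.n<1+n m)) k ⟩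
  Φ (+ 2) (ρ l⁺) 0ʷ k - (Φ 1ℤ (+ suc l⁺ ∷ ρ l) 0ʷ k - Φ 0ℤ (+ suc l⁺ ∷ + l⁺ ∷ ρ m) 0ʷ k)
    ≡⟨ cong₂ _-_ (Φ-2-ρ≈oddPowers (suc (suc m)) k) (cong₂ _-_
         (trans (Φ-1-K₁ l k) (trans (↑-cong (∑K₁≈powers (suc (suc m))) k) (↑-powers l⁺ k)))
         (trans (Φ-0 (+ suc l⁺ ∷ + l⁺ ∷ ρ m) 0ʷ k) (trans (𝒩-11 m k)
           (cong₂ _-_ (trans (↑-cong (∑K₁≈powers (suc m)) k) (↑-powers l k)) (K₂≈oddPowers (suc m) k))))) ⟩
  oddPowers l k + q^ (suc (l ℕ.+ l)) k + q^ (suc (l⁺ ℕ.+ l⁺)) k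
    - (powers l k + (q^ (l ℕ.+ l) k + q^ (suc (l ℕ.+ l)) k) - 𝟙 k + q^ (l⁺ ℕ.+ l⁺) k
        - (powers l k - 𝟙 k + q^ (l ℕ.+ l) k - oddPowers l k))
    ≡⟨ lemma (oddPowers l k) (q^ (suc (l ℕ.+ l)) k) (q^ (suc (l⁺ ℕ.+ l⁺)) k) (powers l k) (q^ (l ℕ.+ l) k) (𝟙 k) (q^ (l⁺ ℕ.+ l⁺) k) ⟩
  q^ (suc (l⁺ ℕ.+ l⁺)) k - q^ (l⁺ ℕ.+ l⁺) k ∎
  where
  open ≡-Reasoning
  l  = suc m
  l⁺ = suc l
  lemma : ∀ o y x p z a w → o + y + x - (p + (z + y) - a + w - (p - a + z - o)) ≡ x - w
  lemma = solve-∀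

-- Fractions

⊛-congˡ : ∀ {f g} h → f ≈ g → f ⊛ h ≈ g ⊛ h
⊛-congˡ h f≈g k = ∑-cong (upTo (suc k)) (λ i → cong (_* h (k ℕ.∸ i)) (f≈g i))

+-⊛ : ∀ f g h k → ((λ i → f i + g i) ⊛ h) k ≡ (f ⊛ h) k + (g ⊛ h) k
+-⊛ f g h k = trans (∑-cong (upTo (suc k)) (λ i → *-distribʳ-+ (h (k ℕ.∸ i)) (f i) (g i)))
  (∑-+ (upTo (suc k)) (λ i → f i * h (k ℕ.∸ i)) (λ i → g i * h (k ℕ.∸ i)))

↑-⊛ : ∀ f g → ↑ f ⊛ g ≈ ↑ (f ⊛ g)
↑-⊛ f g zero    = refl
↑-⊛ f g (suc k) = trans (+-identityˡ _) (cong sumℤ (trans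
  (map-applyUpTo suc (λ i → ↑ f i * g (suc k ℕ.∸ i)) (suc k))
  (sym (map-applyUpTo id (λ i → f i * g (k ℕ.∸ i)) (suc k)))))

𝟙-⊛ : ∀ g → 𝟙 ⊛ g ≈ g
𝟙-⊛ g k = trans (cong₂ _+_ (*-identityˡ (g k)) (trans
    (cong (λ is → ∑ is (λ i → 𝟙 i * g (k ℕ.∸ i))) (sym (map-applyUpTo id suc k)))
    (trans (∑-map (upTo k) suc (λ i → 𝟙 i * g (k ℕ.∸ i))) (∑-zero (upTo k) (λ i → refl)))))
  (+-identityʳ _)

q^-⊛ : ∀ j m k → (q^ j ⊛ (q^ m ⊖ 𝟙)) k ≡ q^ (j ℕ.+ m) k - q^ j k
q^-⊛ zero    m k = 𝟙-⊛ (q^ m ⊖ 𝟙) k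
q^-⊛ (suc j) m k = trans (⊛-congˡ (q^ m ⊖ 𝟙) (λ i → sym (↑-q^ j i)) k) (trans (↑-⊛ (q^ j) (q^ m ⊖ 𝟙) k) (step k))
  where
  step : ∀ k → ↑ (q^ j ⊛ (q^ m ⊖ 𝟙)) k ≡ q^ (suc j ℕ.+ m) k - q^ (suc j) k
  step zero    = refl
  step (suc k) = q^-⊛ j m k

-- Telescoping: q^(2i+1) (q² - 1) is a difference of consecutive odd powers.
oddPowers-⊛ : ∀ m k → (oddPowers m ⊛ (q^ 2 ⊖ 𝟙)) k ≡ q^ (suc (m ℕ.+ m)) k - q^ 1 k
oddPowers-⊛ zero    k = trans (∑-zero (upTo (suc k)) (λ i → refl)) (sym (+-inverseʳ (q^ 1 k)))
oddPowers-⊛ (suc m) k = begin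
  (oddPowers (suc m) ⊛ (q^ 2 ⊖ 𝟙)) k
    ≡⟨ +-⊛ (oddPowers m) (q^ (suc (m ℕ.+ m))) (q^ 2 ⊖ 𝟙) k ⟩
  (oddPowers m ⊛ (q^ 2 ⊖ 𝟙)) k + (q^ (suc (m ℕ.+ m)) ⊛ (q^ 2 ⊖ 𝟙)) k
    ≡⟨ cong₂ _+_ (oddPowers-⊛ m k) (q^-⊛ (suc (m ℕ.+ m)) 2 k) ⟩
  q^ (suc (m ℕ.+ m)) k - q^ 1 k + (q^ (suc (m ℕ.+ m) ℕ.+ 2) k - q^ (suc (m ℕ.+ m)) k)
    ≡⟨ lemma (q^ (suc (m ℕ.+ m)) k) (q^ 1 k) (q^ (suc (m ℕ.+ m) ℕ.+ 2) k) ⟩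
  q^ (suc (m ℕ.+ m) ℕ.+ 2) k - q^ 1 k
    ≡⟨ cong (λ j → q^ j k - q^ 1 k) (trans (ℕₚ.+-comm (suc (m ℕ.+ m)) 2) (cong suc (sym (suc-+-suc m)))) ⟩
  q^ (suc (suc m ℕ.+ suc m)) k - q^ 1 k ∎
  where
  open ≡-Reasoning
  lemma : ∀ a b c → a - b + (c - a) ≡ c - b
  lemma = solve-∀

powers-⊛ : ∀ m → powers m ⊛ (q^ 1 ⊖ 𝟙) ≈ q^ (m ℕ.+ m) ⊖ 𝟙
powers-⊛ zero    k = trans (∑-zero (upTo (suc k)) (λ i → refl)) (sym (+-inverseʳ (𝟙 k)))
powers-⊛ (suc m) k = begin
  (powers (suc m) ⊛ (q^ 1 ⊖ 𝟙)) k
    ≡⟨ trans (+-⊛ (powers m) (λ i → q^ (m ℕ.+ m) i + q^ (suc (m ℕ.+ m)) i) (q^ 1 ⊖ 𝟙) k)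
         (cong₂ _+_ (powers-⊛ m k) (trans (+-⊛ (q^ (m ℕ.+ m)) (q^ (suc (m ℕ.+ m))) (q^ 1 ⊖ 𝟙) k)
           (cong₂ _+_ (q^-⊛ (m ℕ.+ m) 1 k) (q^-⊛ (suc (m ℕ.+ m)) 1 k)))) ⟩
  q^ (m ℕ.+ m) k - 𝟙 k + (q^ (m ℕ.+ m ℕ.+ 1) k - q^ (m ℕ.+ m) k + (q^ (suc (m ℕ.+ m) ℕ.+ 1) k - q^ (suc (m ℕ.+ m)) k))
    ≡⟨ cong₂ (λ i j → q^ (m ℕ.+ m) k - 𝟙 k + (q^ i k - q^ (m ℕ.+ m) k + (q^ j k - q^ (suc (m ℕ.+ m)) k)))
         (ℕₚ.+-comm (m ℕ.+ m) 1) (trans (ℕₚ.+-comm (suc (m ℕ.+ m)) 1) (sym (suc-+-suc m))) ⟩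
  q^ (m ℕ.+ m) k - 𝟙 k + (q^ (suc (m ℕ.+ m)) k - q^ (m ℕ.+ m) k + (q^ (suc m ℕ.+ suc m) k - q^ (suc (m ℕ.+ m)) k))
    ≡⟨ lemma (q^ (m ℕ.+ m) k) (𝟙 k) (q^ (suc (m ℕ.+ m)) k) (q^ (suc m ℕ.+ suc m) k) ⟩
  q^ (suc m ℕ.+ suc m) k - 𝟙 k ∎
  where
  open ≡-Reasoning
  lemma : ∀ x a y z → x - a + (y - x + (z - y)) ≡ z - a
  lemma = solve-∀

-- In this lemma and the next two the exponent comes with an equation, so that 2n, 2n ∸ 2 and 2n ∸ 4
-- can be matched with closed forms at ranks n, n - 1 and n - 2.
oddPowers≈÷ : ∀ {f} m {j} → f ≈ oddPowers m → j ≡ m ℕ.+ m → f ≈ q^ 1 ⊛ (q^ j ⊖ 𝟙) ÷ q^ 2 ⊖ 𝟙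
oddPowers≈÷ m f≈ refl k = trans (⊛-congˡ (q^ 2 ⊖ 𝟙) f≈ k) (trans (oddPowers-⊛ m k) (sym (q^-⊛ 1 (m ℕ.+ m) k)))

↑-oddPowers≈÷ : ∀ {f} m {j} → f ≈ ↑ (oddPowers m) → j ≡ m ℕ.+ m → f ≈ q^ 2 ⊛ (q^ j ⊖ 𝟙) ÷ q^ 2 ⊖ 𝟙
↑-oddPowers≈÷ m f≈ refl k = trans (⊛-congˡ (q^ 2 ⊖ 𝟙) f≈ k)
  (trans (↑-⊛ (oddPowers m) (q^ 2 ⊖ 𝟙) k) (trans (step k) (sym (q^-⊛ 2 (m ℕ.+ m) k))))
  where
  step : ∀ k → ↑ (oddPowers m ⊛ (q^ 2 ⊖ 𝟙)) k ≡ q^ (2 ℕ.+ (m ℕ.+ m)) k - q^ 2 k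
  step zero    = refl
  step (suc k) = oddPowers-⊛ m k

↑-powers≈÷ : ∀ {f} m {j} → f ≈ ↑ (powers m) → j ≡ m ℕ.+ m → f ≈ q^ 1 ⊛ (q^ j ⊖ 𝟙) ÷ q^ 1 ⊖ 𝟙
↑-powers≈÷ m f≈ refl k = trans (⊛-congˡ (q^ 1 ⊖ 𝟙) f≈ k)
  (trans (↑-⊛ (powers m) (q^ 1 ⊖ 𝟙) k) (trans (step k) (sym (q^-⊛ 1 (m ℕ.+ m) k))))
  where
  step : ∀ k → ↑ (powers m ⊛ (q^ 1 ⊖ 𝟙)) k ≡ q^ (suc (m ℕ.+ m)) k - q^ 1 k
  step zero    = refl
  step (suc k) = powers-⊛ m k

2*m≡m+m : ∀ m → 2 ℕ.* m ≡ m ℕ.+ m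
2*m≡m+m m = cong (m ℕ.+_) (ℕₚ.+-identityʳ m)

2*[1+m]∸2≡m+m : ∀ m → 2 ℕ.* suc m ℕ.∸ 2 ≡ m ℕ.+ m
2*[1+m]∸2≡m+m m = cong (ℕ._∸ 2) (trans (2*m≡m+m (suc m)) (suc-+-suc m))

2*[2+m]∸4≡m+m : ∀ m → 2 ℕ.* suc (suc m) ℕ.∸ 4 ≡ m ℕ.+ m
2*[2+m]∸4≡m+m m = cong (ℕ._∸ 4) (trans (2*m≡m+m (suc (suc m)))
  (trans (suc-+-suc (suc m)) (cong (λ j → suc (suc j)) (suc-+-suc m))))

-- The Kostka–Foulkes polynomials

complete-[] : ∀ n → complete n [] ≡ 0ʷ
complete-[] zero    = refl
complete-[] (suc n) = cong (0ℤ ∷_) (complete-[] n)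

complete-[]-+ρ : ∀ n → complete n [] +ʷ ρ n ≡ ρ n
complete-[]-+ρ n = trans (cong (_+ʷ ρ n) (complete-[] n)) (+ʷ-identityˡ (ρ n))

total-complete : ∀ n xs → length xs ℕ.≤ n → total (complete n xs) ≡ + sum xs
total-complete n       []       _         = trans (cong total (complete-[] n)) (total-0ʷ n)
total-complete (suc n) (x ∷ xs) (s≤s len) = cong (_+_ (+ x)) (total-complete n xs len)

K-Odd : ∀ n lam μ → length lam ℕ.≤ n → length μ ℕ.≤ n → Odd (+ sum lam - + sum μ) → K n lam μ ≈ 𝟘
K-Odd n lam μ lam≤ μ≤ odd = kostkaFoulkes-Odd (complete n lam) (complete n μ)
  (subst Odd (sym (cong₂ _-_ (total-complete n lam lam≤) (total-complete n μ μ≤))) odd)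

K≈𝒩 : ∀ {n} lam μ {a v} → complete n lam +ʷ ρ n ≡ a → complete n μ ≡ v → K n lam μ ≈ 𝒩 a v
K≈𝒩 {n} lam μ refl refl = kostkaFoulkes≈𝒩 (complete n lam) (complete n μ)

-- The entry m + 4 exceeds b = m + 2 by 2 and leaves ρ. The same coefficient arises for λ = (2) and
-- μ = ∅, so the two polynomials agree.
K-3-1 : ∀ m → K (suc m) (3 ∷ []) (1 ∷ []) ≈ oddPowers (suc m)
K-3-1 m k = begin
  K (suc m) (3 ∷ []) (1 ∷ []) k
    ≡⟨ K≈𝒩 (3 ∷ []) (1 ∷ []) (cong (+ (3 ℕ.+ suc m) ∷_) (complete-[]-+ρ m)) (cong (1ℤ ∷_) (complete-[] m)) k ⟩
  𝒩 (+ (3 ℕ.+ suc m) ∷ ρ m) (1ℤ ∷ 0ʷ) k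
    ≡⟨ 𝒩-head (ρ m) 1ℤ 0ʷ 2 (cong +_ (ℕₚ.+-comm (suc m) 1)) refl (ρ-Below m (ℕₚ.m<n+m m {2} ℕ.z<s)) k ⟩
  Φ (+ 2) (ρ m) 0ʷ k
    ≡⟨ Φ-2-ρ≈oddPowers m k ⟩
  oddPowers (suc m) k ∎
  where open ≡-Reasoning

K-2-∅ : ∀ m → K (suc m) (2 ∷ []) [] ≈ oddPowers (suc m)
K-2-∅ m k = trans
  (K≈𝒩 (2 ∷ []) [] (cong (+ (2 ℕ.+ suc m) ∷_) (complete-[]-+ρ m)) (cong (0ℤ ∷_) (complete-[] m)) k)
  (K₂≈oddPowers (suc m) k)

K-2-2 : ∀ m → K (suc m) (2 ∷ []) (2 ∷ []) ≈ 𝟙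
K-2-2 m k = begin
  K (suc m) (2 ∷ []) (2 ∷ []) k
    ≡⟨ K≈𝒩 (2 ∷ []) (2 ∷ []) (cong (+ (2 ℕ.+ suc m) ∷_) (complete-[]-+ρ m)) (cong (+ 2 ∷_) (complete-[] m)) k ⟩
  𝒩 (+ (2 ℕ.+ suc m) ∷ ρ m) (+ 2 ∷ 0ʷ) k
    ≡⟨ 𝒩-head (ρ m) (+ 2) 0ʷ 0 (cong +_ (ℕₚ.+-comm (suc m) 2)) refl (ρ-Below m (ℕₚ.m<n+m m {3} ℕ.z<s)) k ⟩
  Φ 0ℤ (ρ m) 0ʷ k
    ≡⟨ trans (Φ-0 (ρ m) 0ʷ k) (𝒩-ρ-0ʷ m k) ⟩
  𝟙 k ∎
  where open ≡-Reasoning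

K-2-11 : ∀ m → K (suc (suc m)) (2 ∷ []) (1 ∷ 1 ∷ []) ≈ q^ 1
K-2-11 m k = begin
  K (suc (suc m)) (2 ∷ []) (1 ∷ 1 ∷ []) k
    ≡⟨ K≈𝒩 (2 ∷ []) (1 ∷ 1 ∷ []) (cong (+ (2 ℕ.+ suc (suc m)) ∷_) (complete-[]-+ρ (suc m)))
         (cong (λ v → 1ℤ ∷ 1ℤ ∷ v) (complete-[] m)) k ⟩
  𝒩 (+ (2 ℕ.+ suc (suc m)) ∷ ρ (suc m)) (1ℤ ∷ 1ℤ ∷ 0ʷ) k
    ≡⟨ 𝒩-head (ρ (suc m)) 1ℤ (1ℤ ∷ 0ʷ) 1 (cong +_ (ℕₚ.+-comm (suc (suc m)) 1)) refl
         (ρ-Below (suc m) (ℕₚ.m<n+m (suc m) {2} ℕ.z<s)) k ⟩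
  Φ 1ℤ (ρ (suc m)) (1ℤ ∷ 0ʷ) k
    ≡⟨ Φ-1 (ρ (suc m)) (1ℤ ∷ 0ʷ) k ⟩
  ↑ (λ i → ∑ (V (suc m)) (λ w → 𝒩 (ρ (suc m)) ((1ℤ ∷ 0ʷ) +ʷ w) i)) k
    ≡⟨ ↑-cong single k ⟩
  ↑ 𝟙 k
    ≡⟨ ↑-q^ 0 k ⟩
  q^ 1 k ∎
  where
  open ≡-Reasoning
  -- Only the weight w with first coordinate -1 cancels the 1 of μ; every other w leaves a positive
  -- first coordinate and contributes 0.
  single : (λ i → ∑ (V (suc m)) (λ w → 𝒩 (ρ (suc m)) ((1ℤ ∷ 0ʷ) +ʷ w) i)) ≈ 𝟙
  single i = trans (∑-V-suc m (λ w → 𝒩 (ρ (suc m)) ((1ℤ ∷ 0ʷ) +ʷ w) i)) (trans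
    (cong₂ _+_ (𝒩-ρ-pos m 1 (0ʷ +ʷ 0ʷ) i) (cong₂ _+_
      (trans (cong (λ v → 𝒩 (ρ (suc m)) (0ℤ ∷ v) i) (+ʷ-identityˡ 0ʷ)) (𝒩-ρ-0ʷ (suc m) i))
      (∑-zero (V m) (λ w → 𝒩-ρ-pos m 0 (0ʷ +ʷ w) i))))
    (trans (+-identityˡ _) (+-identityʳ _)))

-- Only the first entry reaches b, with excess 1; what remains is (1) + ρ, so the sum of K_{(1),v}
-- over the vector weights appears.
K-21-1 : ∀ m → K (suc (suc m)) (2 ∷ 1 ∷ []) (1 ∷ []) ≈ ↑ (powers (suc m))
K-21-1 m k = begin
  K (suc (suc m)) (2 ∷ 1 ∷ []) (1 ∷ []) k
    ≡⟨ K≈𝒩 (2 ∷ 1 ∷ []) (1 ∷ []) (cong (λ v → + (2 ℕ.+ suc (suc m)) ∷ + suc (suc m) ∷ v) (complete-[]-+ρ m))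
         (cong (1ℤ ∷_) (complete-[] (suc m))) k ⟩
  𝒩 (+ (2 ℕ.+ suc (suc m)) ∷ + suc (suc m) ∷ ρ m) (1ℤ ∷ 0ʷ) k
    ≡⟨ 𝒩-head (+ suc (suc m) ∷ ρ m) 1ℤ 0ʷ 1 (cong +_ (ℕₚ.+-comm (suc (suc m)) 1)) refl
         ((suc m , refl , ℕₚ.n<1+n (suc (suc m))) ∷ ρ-Below m (ℕₚ.m<n+m m {3} ℕ.z<s)) k ⟩
  Φ 1ℤ (+ suc (suc m) ∷ ρ m) 0ʷ k
    ≡⟨ trans (Φ-1-K₁ m k) (↑-cong (∑K₁≈powers (suc m)) k) ⟩
  ↑ (powers (suc m)) k ∎
  where open ≡-Reasoning

𝒩-11≈↑-oddPowers : ∀ m → 𝒩 (+ suc (suc (suc m)) ∷ + suc (suc m) ∷ ρ m) 0ʷ ≈ ↑ (oddPowers (suc m))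
𝒩-11≈↑-oddPowers m k = begin
  𝒩 (+ suc (suc (suc m)) ∷ + suc (suc m) ∷ ρ m) 0ʷ k
    ≡⟨ 𝒩-11 m k ⟩
  ↑ (∑K₁ (suc m)) k - K₂ (suc m) k
    ≡⟨ cong₂ _-_ (trans (↑-cong (∑K₁≈powers (suc m)) k) (↑-powers-split (suc m) k)) (K₂≈oddPowers (suc m) k) ⟩
  oddPowers (suc m) k + ↑ (oddPowers (suc m)) k - oddPowers (suc m) k
    ≡⟨ lemma (oddPowers (suc m) k) (↑ (oddPowers (suc m)) k) ⟩
  ↑ (oddPowers (suc m)) k ∎
  where
  open ≡-Reasoning
  lemma : ∀ a b → a + b - a ≡ b
  lemma = solve-∀

K-11-∅ : ∀ m → K (suc (suc m)) (1 ∷ 1 ∷ []) [] ≈ ↑ (oddPowers (suc m))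
K-11-∅ m k = trans
  (K≈𝒩 (1 ∷ 1 ∷ []) [] (cong (λ v → + suc (suc (suc m)) ∷ + suc (suc m) ∷ v) (complete-[]-+ρ m))
    (complete-[] (suc (suc m))) k)
  (𝒩-11≈↑-oddPowers m k)

-- λ + ρ and μ + ρ agree in the first coordinate. Removing it leaves λ = (1,1) and μ = ∅ in the next
-- lower rank.
K-111-1 : ∀ m → K (suc (suc (suc m))) (1 ∷ 1 ∷ 1 ∷ []) (1 ∷ []) ≈ ↑ (oddPowers (suc m))
K-111-1 m k = begin
  K (suc (suc (suc m))) (1 ∷ 1 ∷ 1 ∷ []) (1 ∷ []) k
    ≡⟨ K≈𝒩 (1 ∷ 1 ∷ 1 ∷ []) (1 ∷ [])
         (cong (λ v → + (4 ℕ.+ m) ∷ + (3 ℕ.+ m) ∷ + (2 ℕ.+ m) ∷ v) (complete-[]-+ρ m))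
         (cong (1ℤ ∷_) (complete-[] (suc (suc m)))) k ⟩
  𝒩 (+ (4 ℕ.+ m) ∷ + (3 ℕ.+ m) ∷ + (2 ℕ.+ m) ∷ ρ m) (1ℤ ∷ 0ʷ) k
    ≡⟨ 𝒩-head (+ (3 ℕ.+ m) ∷ + (2 ℕ.+ m) ∷ ρ m) 1ℤ 0ʷ 0 (cong +_ (ℕₚ.+-comm (3 ℕ.+ m) 1)) refl
         ((2 ℕ.+ m , refl , ℕₚ.n<1+n (3 ℕ.+ m)) ∷ (1 ℕ.+ m , refl , ℕₚ.m<n+m (2 ℕ.+ m) {2} ℕ.z<s) ∷
          ρ-Below m (ℕₚ.m<n+m m {4} ℕ.z<s)) k ⟩
  Φ 0ℤ (+ (3 ℕ.+ m) ∷ + (2 ℕ.+ m) ∷ ρ m) 0ʷ k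
    ≡⟨ trans (Φ-0 (+ (3 ℕ.+ m) ∷ + (2 ℕ.+ m) ∷ ρ m) 0ʷ k) (𝒩-11≈↑-oddPowers m k) ⟩
  ↑ (oddPowers (suc m)) k ∎
  where open ≡-Reasoning

K-11-11 : ∀ m → K (suc (suc m)) (1 ∷ 1 ∷ []) (1 ∷ 1 ∷ []) ≈ 𝟙
K-11-11 m k = begin
  K (suc (suc m)) (1 ∷ 1 ∷ []) (1 ∷ 1 ∷ []) k
    ≡⟨ K≈𝒩 (1 ∷ 1 ∷ []) (1 ∷ 1 ∷ []) (cong (λ v → + suc (suc (suc m)) ∷ + suc (suc m) ∷ v) (complete-[]-+ρ m))
         (cong (λ v → 1ℤ ∷ 1ℤ ∷ v) (complete-[] m)) k ⟩
  𝒩 (+ suc (suc (suc m)) ∷ + suc (suc m) ∷ ρ m) (1ℤ ∷ 1ℤ ∷ 0ʷ) k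
    ≡⟨ 𝒩-head (+ suc (suc m) ∷ ρ m) 1ℤ (1ℤ ∷ 0ʷ) 0 (cong +_ (ℕₚ.+-comm (suc (suc m)) 1)) refl
         ((suc m , refl , ℕₚ.n<1+n (suc (suc m))) ∷ ρ-Below m (ℕₚ.m<n+m m {3} ℕ.z<s)) k ⟩
  Φ 0ℤ (+ suc (suc m) ∷ ρ m) (1ℤ ∷ 0ʷ) k
    ≡⟨ Φ-0 (+ suc (suc m) ∷ ρ m) (1ℤ ∷ 0ʷ) k ⟩
  K₁ (suc m) (1ℤ ∷ 0ʷ) k
    ≡⟨ trans (K₁-1 m 0ʷ k) (𝒩-ρ-0ʷ m k) ⟩
  𝟙 k ∎
  where open ≡-Reasoning

-- The first coordinate m + 4 of μ + ρ exceeds every entry of λ + ρ.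
K-11-2 : ∀ m → K (suc (suc m)) (1 ∷ 1 ∷ []) (2 ∷ []) ≈ 𝟘
K-11-2 m k = trans
  (K≈𝒩 (1 ∷ 1 ∷ []) (2 ∷ []) (cong (λ v → + suc (suc (suc m)) ∷ + suc (suc m) ∷ v) (complete-[]-+ρ m)) refl k)
  (𝒩-Below (+ suc (suc (suc m)) ∷ + suc (suc m) ∷ ρ m) (+ 2) (complete (suc m) [])
    (cong +_ (ℕₚ.+-comm (suc (suc m)) 2))
    ((suc (suc m) , refl , ℕₚ.n<1+n (suc (suc (suc m)))) ∷ (suc m , refl , ℕₚ.m<n+m (suc (suc m)) {2} ℕ.z<s) ∷
     ρ-Below m (ℕₚ.m<n+m m {4} ℕ.z<s)) k)

mainTheorem7 : (n : ℕ) → 3 ℕ.≤ n →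
    ( (K n (3 ∷ []) (2 ∷ []) ≈ 𝟘)
    × (K n (3 ∷ []) (1 ∷ 1 ∷ []) ≈ 𝟘)
    × (K n (3 ∷ []) [] ≈ 𝟘)
    × (K n (3 ∷ []) (1 ∷ []) ≈ q^ 1 ⊛ (q^ (2 ℕ.* n) ⊖ 𝟙) ÷ q^ 2 ⊖ 𝟙))
    × ( (K n (2 ∷ 1 ∷ []) (2 ∷ []) ≈ 𝟘)
    × (K n (2 ∷ 1 ∷ []) (1 ∷ 1 ∷ []) ≈ 𝟘)
    × (K n (2 ∷ 1 ∷ []) [] ≈ 𝟘)
    × (K n (2 ∷ 1 ∷ []) (1 ∷ []) ≈ q^ 1 ⊛ (q^ (2 ℕ.* n ℕ.∸ 2) ⊖ 𝟙) ÷ q^ 1 ⊖ 𝟙))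
    × ( (K n (1 ∷ 1 ∷ 1 ∷ []) (2 ∷ []) ≈ 𝟘)
    × (K n (1 ∷ 1 ∷ 1 ∷ []) (1 ∷ 1 ∷ []) ≈ 𝟘)
    × (K n (1 ∷ 1 ∷ 1 ∷ []) [] ≈ 𝟘)
    × (K n (1 ∷ 1 ∷ 1 ∷ []) (1 ∷ []) ≈ q^ 2 ⊛ (q^ (2 ℕ.* n ℕ.∸ 4) ⊖ 𝟙) ÷ q^ 2 ⊖ 𝟙))
    × ( (K n (2 ∷ []) (2 ∷ []) ≈ 𝟙)
    × (K n (2 ∷ []) (1 ∷ 1 ∷ []) ≈ q^ 1)
    × (K n (2 ∷ []) (1 ∷ []) ≈ 𝟘)
    × (K n (2 ∷ []) [] ≈ q^ 1 ⊛ (q^ (2 ℕ.* n) ⊖ 𝟙) ÷ q^ 2 ⊖ 𝟙))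
    × ( (K n (1 ∷ 1 ∷ []) (2 ∷ []) ≈ 𝟘)
    × (K n (1 ∷ 1 ∷ []) (1 ∷ 1 ∷ []) ≈ 𝟙)
    × (K n (1 ∷ 1 ∷ []) (1 ∷ []) ≈ 𝟘)
    × (K n (1 ∷ 1 ∷ []) [] ≈ q^ 2 ⊛ (q^ (2 ℕ.* n ℕ.∸ 2) ⊖ 𝟙) ÷ q^ 2 ⊖ 𝟙))
mainTheorem7 n@(suc (suc (suc m))) n≥3@(s≤s (s≤s (s≤s z≤n))) =
  -- The integer in each parity witness is (|λ| - |μ| - 1) / 2.
  ( K-Odd n (3 ∷ []) (2 ∷ []) n≥1 n≥1 (0ℤ , refl)
  , K-Odd n (3 ∷ []) (1 ∷ 1 ∷ []) n≥1 n≥2 (0ℤ , refl)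
  , K-Odd n (3 ∷ []) [] n≥1 z≤n (1ℤ , refl)
  , oddPowers≈÷ (3 ℕ.+ m) (K-3-1 (2 ℕ.+ m)) (2*m≡m+m (3 ℕ.+ m)) ) ,
  ( K-Odd n (2 ∷ 1 ∷ []) (2 ∷ []) n≥2 n≥1 (0ℤ , refl)
  , K-Odd n (2 ∷ 1 ∷ []) (1 ∷ 1 ∷ []) n≥2 n≥2 (0ℤ , refl)
  , K-Odd n (2 ∷ 1 ∷ []) [] n≥2 z≤n (1ℤ , refl)
  , ↑-powers≈÷ (2 ℕ.+ m) (K-21-1 (1 ℕ.+ m)) (2*[1+m]∸2≡m+m (2 ℕ.+ m)) ) ,
  ( K-Odd n (1 ∷ 1 ∷ 1 ∷ []) (2 ∷ []) n≥3 n≥1 (0ℤ , refl)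
  , K-Odd n (1 ∷ 1 ∷ 1 ∷ []) (1 ∷ 1 ∷ []) n≥3 n≥2 (0ℤ , refl)
  , K-Odd n (1 ∷ 1 ∷ 1 ∷ []) [] n≥3 z≤n (1ℤ , refl)
  , ↑-oddPowers≈÷ (1 ℕ.+ m) (K-111-1 m) (2*[2+m]∸4≡m+m (1 ℕ.+ m)) ) ,
  ( K-2-2 (2 ℕ.+ m)
  , K-2-11 (1 ℕ.+ m)
  , K-Odd n (2 ∷ []) (1 ∷ []) n≥1 n≥1 (0ℤ , refl)
  , oddPowers≈÷ (3 ℕ.+ m) (K-2-∅ (2 ℕ.+ m)) (2*m≡m+m (3 ℕ.+ m)) ) ,
  ( K-11-2 (1 ℕ.+ m)
  , K-11-11 (1 ℕ.+ m)
  , K-Odd n (1 ∷ 1 ∷ []) (1 ∷ []) n≥2 n≥1 (0ℤ , refl)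
  , ↑-oddPowers≈÷ (2 ℕ.+ m) (K-11-∅ (1 ℕ.+ m)) (2*[1+m]∸2≡m+m (2 ℕ.+ m)) )
  where
  n≥1 : 1 ℕ.≤ n
  n≥1 = s≤s z≤n
  n≥2 : 2 ℕ.≤ n
  n≥2 = s≤s (s≤s z≤n)
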